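{- For every odd prime $m$, integer $\beta \geq 2$, and integer $k$ with $1 \leq k \leq m-1$, the group \[ \Gamma^{2m, m^{\beta}}(3,\ 1+km^{\beta-1},\ -3,\ -1+km^{\beta-1}) \] is the automorphism group of a tight chiral polyhedron of type $\{2m, m^{\beta}\}$.
   Context: For integers $p,q,i_1,j_1,i_2,j_2$, $\Gamma^{p,q}(i_1,j_1,i_2,j_2)$ denotes the group with presentation $\langle \sigma_1,\sigma_2 \mid \sigma_1^p=\sigma_2^q=(\sigma_1\sigma_2)^2=1,\ \sigma_2^{ -1}\sigma_1=\sigma_1^{i_1}\sigma_2^{j_1},\ \sigma_2\sigma_1^{ -1}=\sigma_1^{i_2}\sigma_2^{j_2}\rangle$. An (abstract) polyhedron is a partially ordered set whose elements have rank $0$, $1$, $2$ (vertices, edges, faces), incidence meaning comparability, such that every edge is incident to exactly two vertices and two faces, whenever a vertex is incident to a face exactly two edges are incident to both, the incidence graph is connected, and for each vertex or face the subgraph of the incidence graph induced on its neighbours is connected. A flag is a mutually incident (vertex, edge, face) triple; $\Phi^i$ is the flag differing from $\Phi$ exactly in its rank-$i$ element. Type $\{p,q\}$: faces are incident to $p$ edges and vertices to $q$ edges. The polyhedron is chiral if its flags split into two classes with $\Phi,\Phi^i$ always in different classes and the automorphism group transitive on each class but not on all flags; then, fixing a base flag $\Phi$, the automorphism group is generated by $\sigma_1:\Phi\mapsto(\Phi^1)^0$ and $\sigma_2:\Phi\mapsto(\Phi^2)^1$. A group $\langle\sigma_1,\sigma_2\rangle$ "is the automorphism group of" such a polyhedron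 if there is an isomorphism onto it sending the generators $\sigma_1,\sigma_2$ to these distinguished generators. A polyhedron of type $\{p,q\}$ is tight if it has exactly $2pq$ flags. -}

module Defs where

open import Level using (0ℓ)
open import Data.Bool using (Bool; true; false)
open import Data.Nat as ℕ using (ℕ; zero; suc)
open import Data.Integer as ℤ using (ℤ; +_; -[1+_])
open import Data.Fin using (Fin)
open import Data.Sum using (_⊎_; inj₁; inj₂)
open import Data.Product using (Σ; ∃; _×_; _,_; proj₁; proj₂)
open import Relation.Binary.PropositionalEquality using (_≡_; _≢_)
open import Relation.Binary.Construct.Closure.ReflexiveTransitive using (Star)
open import Relation.Nullary using (¬_)
open import Function.Bundles using (_↔_; Inverse)
open Inverse using (to; from)
open import Data.Empty using (⊥)
open import Data.Fin as Fin using ()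

data Word : Set where
  σ₁ σ₂ ε : Word
  _·_     : Word → Word → Word
  _⁻¹     : Word → Word

infixl 7 _·_
infix  8 _⁻¹

pow : Word → ℕ → Word
pow w zero    = ε
pow w (suc n) = w · pow w n

zpow : Word → ℤ → Word
zpow w (+ n)      = pow w n
zpow w -[1+ n ]   = pow (w ⁻¹) (suc n)

-- The congruence on words defining the group
--   Γ^{p,q}(i₁,j₁,i₂,j₂) = ⟨ σ₁, σ₂ | σ₁^p = σ₂^q = (σ₁σ₂)^2 = 1,
--        σ₂⁻¹σ₁ = σ₁^{i₁}σ₂^{j₁},  σ₂σ₁⁻¹ = σ₁^{i₂}σ₂^{j₂} ⟩.
-- Two words are equal in Γ iff they are related by this relation.
data Γ≈ (p q : ℕ) (i₁ j₁ i₂ j₂ : ℤ) : Word → Word → Set where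
  ≈-refl  : ∀ {w} → Γ≈ p q i₁ j₁ i₂ j₂ w w
  ≈-sym   : ∀ {u w} → Γ≈ p q i₁ j₁ i₂ j₂ u w → Γ≈ p q i₁ j₁ i₂ j₂ w u
  ≈-trans : ∀ {u v w} → Γ≈ p q i₁ j₁ i₂ j₂ u v → Γ≈ p q i₁ j₁ i₂ j₂ v w →
            Γ≈ p q i₁ j₁ i₂ j₂ u w
  ·-cong  : ∀ {u u′ w w′} → Γ≈ p q i₁ j₁ i₂ j₂ u u′ → Γ≈ p q i₁ j₁ i₂ j₂ w w′ →
            Γ≈ p q i₁ j₁ i₂ j₂ (u · w) (u′ · w′)
  ⁻¹-cong : ∀ {u w} → Γ≈ p q i₁ j₁ i₂ j₂ u w → Γ≈ p q i₁ j₁ i₂ j₂ (u ⁻¹) (w ⁻¹)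
  assoc   : ∀ u v w → Γ≈ p q i₁ j₁ i₂ j₂ ((u · v) · w) (u · (v · w))
  idˡ     : ∀ w → Γ≈ p q i₁ j₁ i₂ j₂ (ε · w) w
  idʳ     : ∀ w → Γ≈ p q i₁ j₁ i₂ j₂ (w · ε) w
  invˡ    : ∀ w → Γ≈ p q i₁ j₁ i₂ j₂ (w ⁻¹ · w) ε
  invʳ    : ∀ w → Γ≈ p q i₁ j₁ i₂ j₂ (w · w ⁻¹) ε
  rel₁    : Γ≈ p q i₁ j₁ i₂ j₂ (pow σ₁ p) ε
  rel₂    : Γ≈ p q i₁ j₁ i₂ j₂ (pow σ₂ q) ε
  rel₃    : Γ≈ p q i₁ j₁ i₂ j₂ (pow (σ₁ · σ₂) 2) ε
  rel₄    : Γ≈ p q i₁ j₁ i₂ j₂ (σ₂ ⁻¹ · σ₁) (zpow σ₁ i₁ · zpow σ₂ j₁)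
  rel₅    : Γ≈ p q i₁ j₁ i₂ j₂ (σ₂ · σ₁ ⁻¹) (zpow σ₁ i₂ · zpow σ₂ j₂)

-- A partially ordered set with elements of rank 0,1,2, given by its three
-- rank classes and the (Boolean) incidence relations between them.
-- Elements of equal rank are incomparable; transitivity of the order is
-- the field ive-ief⇒ivf.
record RankedPoset : Set₁ where
  field
    V E F : Set
    IVE : V → E → Bool
    IEF : E → F → Bool
    IVF : V → F → Bool
    ive-ief⇒ivf : ∀ {v e f} → IVE v e ≡ true → IEF e f ≡ true → IVF v f ≡ true

  Elt : Set
  Elt = V ⊎ (E ⊎ F)

  Inc : Elt → Elt → Set
  Inc (inj₁ v)        (inj₂ (inj₁ e)) = IVE v e ≡ true
  Inc (inj₁ v)        (inj₂ (inj₂ f)) = IVF v f ≡ true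
  Inc (inj₂ (inj₁ e)) (inj₁ v)        = IVE v e ≡ true
  Inc (inj₂ (inj₁ e)) (inj₂ (inj₂ f)) = IEF e f ≡ true
  Inc (inj₂ (inj₂ f)) (inj₁ v)        = IVF v f ≡ true
  Inc (inj₂ (inj₂ f)) (inj₂ (inj₁ e)) = IEF e f ≡ true
  Inc _               _               = ⊥

  InducedConnected : (Elt → Set) → Set
  InducedConnected P =
    (x y : Σ Elt P) →
    Star (λ (a b : Σ Elt P) → Inc (proj₁ a) (proj₁ b)) x y

  record Flag : Set where
    constructor flag
    field
      fv : V
      fe : E
      ff : F
      ve : IVE fv fe ≡ true
      ef : IEF fe ff ≡ true
      vf : IVF fv ff ≡ true

  open Flag public

  Adj : Fin 3 → Flag → Flag → Set
  Adj Fin.zero Φ Ψ =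
    fv Φ ≢ fv Ψ × fe Φ ≡ fe Ψ × ff Φ ≡ ff Ψ
  Adj (Fin.suc Fin.zero) Φ Ψ =
    fv Φ ≡ fv Ψ × fe Φ ≢ fe Ψ × ff Φ ≡ ff Ψ
  Adj (Fin.suc (Fin.suc Fin.zero)) Φ Ψ =
    fv Φ ≡ fv Ψ × fe Φ ≡ fe Ψ × ff Φ ≢ ff Ψ

  record Aut : Set where
    field
      autV : V ↔ V
      autE : E ↔ E
      autF : F ↔ F
    field
      pres-VE : ∀ v e → IVE (to autV v) (to autE e) ≡ IVE v e
      pres-EF : ∀ e f → IEF (to autE e) (to autF f) ≡ IEF e f
      pres-VF : ∀ v f → IVF (to autV v) (to autF f) ≡ IVF v f

  record Maps : Set where
    constructor maps
    field
      mV : V → V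
      mE : E → E
      mF : F → F

  _≐_ : Maps → Maps → Set
  m ≐ n = (∀ v → Maps.mV m v ≡ Maps.mV n v) ×
          (∀ e → Maps.mE m e ≡ Maps.mE n e) ×
          (∀ f → Maps.mF m f ≡ Maps.mF n f)

  toMaps : Aut → Maps
  toMaps α = maps (to (Aut.autV α)) (to (Aut.autE α)) (to (Aut.autF α))

  invMaps : Aut → Maps
  invMaps α = maps (from (Aut.autV α)) (from (Aut.autE α)) (from (Aut.autF α))

  Maps-flag : Aut → Flag → Flag → Set
  Maps-flag α Φ Ψ =
    Maps.mV (toMaps α) (fv Φ) ≡ fv Ψ ×
    Maps.mE (toMaps α) (fe Φ) ≡ fe Ψ ×
    Maps.mF (toMaps α) (ff Φ) ≡ ff Ψ

  comp : Maps → Maps → Maps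
  comp m n = maps (λ x → Maps.mV m (Maps.mV n x))
                  (λ x → Maps.mE m (Maps.mE n x))
                  (λ x → Maps.mF m (Maps.mF n x))

  mutual
    eval : Aut → Aut → Word → Maps
    eval s₁ s₂ σ₁ = toMaps s₁
    eval s₁ s₂ σ₂ = toMaps s₂
    eval s₁ s₂ ε  = maps (λ x → x) (λ x → x) (λ x → x)
    eval s₁ s₂ (u · w) = comp (eval s₁ s₂ u) (eval s₁ s₂ w)
    eval s₁ s₂ (w ⁻¹) = evalInv s₁ s₂ w

    evalInv : Aut → Aut → Word → Maps
    evalInv s₁ s₂ σ₁ = invMaps s₁
    evalInv s₁ s₂ σ₂ = invMaps s₂
    evalInv s₁ s₂ ε  = maps (λ x → x) (λ x → x) (λ x → x)
    evalInv s₁ s₂ (u · w) = comp (evalInv s₁ s₂ w) (evalInv s₁ s₂ u)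
    evalInv s₁ s₂ (w ⁻¹) = eval s₁ s₂ w


open import Data.Unit using (⊤)

module _ (P : RankedPoset) where
  open RankedPoset P

  record IsPolyhedron : Set where
    field
      edge-vertices : ∀ e → Σ V (λ v → IVE v e ≡ true) ↔ Fin 2
      edge-faces    : ∀ e → Σ F (λ f → IEF e f ≡ true) ↔ Fin 2
      diamond : ∀ v f → IVF v f ≡ true →
                Σ E (λ e → IVE v e ≡ true × IEF e f ≡ true) ↔ Fin 2
      connected : InducedConnected (λ _ → ⊤)
      vertex-links : ∀ v → InducedConnected (λ x → Inc (inj₁ v) x)
      face-links   : ∀ f → InducedConnected (λ x → Inc (inj₂ (inj₂ f)) x)

  HasType : ℕ → ℕ → Set
  HasType p q =
    (∀ f → Σ E (λ e → IEF e f ≡ true) ↔ Fin p) ×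
    (∀ v → Σ E (λ e → IVE v e ≡ true) ↔ Fin q)

  TransitiveOn : (Flag → Set) → Set
  TransitiveOn S = ∀ Φ Ψ → S Φ → S Ψ → Σ Aut (λ α → Maps-flag α Φ Ψ)

  IsChiral : Set
  IsChiral =
    Σ (Flag → Bool) λ c →
      (∀ i Φ Ψ → Adj i Φ Ψ → c Φ ≢ c Ψ) ×
      (∀ b → TransitiveOn (λ Φ → c Φ ≡ b)) ×
      ¬ TransitiveOn (λ _ → ⊤)

  Tight : ℕ → ℕ → Set
  Tight p q = Flag ↔ Fin (2 ℕ.* p ℕ.* q)

  -- "Γ^{p,q}(i₁,j₁,i₂,j₂) is the automorphism group of P": for some base
  -- flag Φ, with σ₁ : Φ ↦ (Φ¹)⁰ and σ₂ : Φ ↦ (Φ²)¹ the distinguished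
  -- automorphisms, the assignment σᵢ ↦ σᵢ induces a well-defined
  -- injective and surjective homomorphism Γ → Aut(P).
  IsAutGroupOf : (p q : ℕ) (i₁ j₁ i₂ j₂ : ℤ) → Set
  IsAutGroupOf p q i₁ j₁ i₂ j₂ =
    Σ Flag λ Φ → Σ Aut λ s₁ → Σ Aut λ s₂ →
      (Σ Flag λ Φ¹ → Σ Flag λ Ψ →
         Adj (Fin.suc Fin.zero) Φ Φ¹ × Adj Fin.zero Φ¹ Ψ × Maps-flag s₁ Φ Ψ) ×
      (Σ Flag λ Φ² → Σ Flag λ Ψ →
         Adj (Fin.suc (Fin.suc Fin.zero)) Φ Φ² × Adj (Fin.suc Fin.zero) Φ² Ψ ×
         Maps-flag s₂ Φ Ψ) ×
      (∀ u w → Γ≈ p q i₁ j₁ i₂ j₂ u w → eval s₁ s₂ u ≐ eval s₁ s₂ w) ×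
      (∀ u w → eval s₁ s₂ u ≐ eval s₁ s₂ w → Γ≈ p q i₁ j₁ i₂ j₂ u w) ×
      (∀ α → Σ Word λ w → eval s₁ s₂ w ≐ toMaps α)

{-# OPTIONS --safe #-}
-- Put M = m^(β−1), q = m^β, N = kM, so that N² ≡ 0 mod q.  The last relation gives
-- σ₂^(N−1) σ₁ = σ₁³ σ₂, and with σ₁σ₂σ₁ = σ₂⁻¹ this yields σ₁² σ₂⁻¹ = σ₂^(N−1) σ₁²;
-- hence every element has the form σ₂^f σ₁^a and the group has at most 2m·q elements.
-- The coset geometry of the group can be written down explicitly: the vertices are two
-- copies of ℤ/m, the faces are ℤ/q, every vertex lies on every face, and the edge
-- (c , f) ∈ ℤ/m × ℤ/q joins c in the first copy to c − f in the second and separates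
-- the faces f and f + 1 − cN.  Here σ₂ is f ↦ f + 1 and σ₁ is f ↦ −f − (N/2) f (f − 1)
-- on faces.  An automorphism is determined by the image of one flag, so the relations
-- need only be checked at the base flag, where the normal forms are also told apart.
-- An automorphism reversing the colour of flags would conjugate σ₁, σ₂ to inverses (up
-- to conjugacy), turning σ₂^N σ₁² σ₂ = σ₂ σ₁² into a relation that forces 2N ≡ 0 mod q,
-- which fails because m is an odd prime not dividing k.
module Submission where

open import Defs
open import Level using (0ℓ)
open import Axiom.UniquenessOfIdentityProofs.WithK using (uip)
open import Data.Bool using (Bool; true; false; not; _∨_; _xor_)
import Data.Bool.Properties as Bool
open import Data.Nat as ℕ using (ℕ; zero; suc)
import Data.Nat.Properties as ℕ
import Data.Nat.Divisibility as ℕ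
open import Data.Nat.DivMod using (m≡m%n+[m/n]*n)
open import Data.Nat.Primality using (Prime; prime⇒nonZero; prime⇒nonTrivial; euclidsLemma)
open import Data.Integer as ℤ using (ℤ; +_; -[1+_])
import Data.Integer.Properties as ℤ
open import Data.Integer.DivMod using (_/ℕ_; n%ℕd<d; a≡a%ℕn+[a/ℕn]*n)
open import Data.Integer.Divisibility.Signed using (_∣_; divides; ∣⇒∣ᵤ; ∣-trans; ∣m∣n⇒∣m+n; ∣m∣n⇒∣m-n; ∣m⇒∣-m; ∣m⇒∣m*n; ∣n⇒∣m*n)
open import Data.Integer.Solver using (module +-*-Solver)
open import Data.Fin as Fin using (Fin; toℕ; fromℕ<)
import Data.Fin.Properties as Fin
open import Data.Empty using (⊥; ⊥-elim)
import Data.Maybe as Maybe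
open import Data.Unit using (⊤; tt)
open import Data.Sum using (_⊎_; inj₁; inj₂)
open import Data.Product using (Σ; ∃; _×_; _,_; proj₁; proj₂)
open import Data.Product.Properties using (≡-dec)
open import Data.Product.Function.NonDependent.Propositional using (_×-↔_)
open import Function.Bundles using (_↔_; Inverse; mk↔ₛ′; mk⇔)
open import Function.Properties.Inverse using (↔-refl; ↔-sym; ↔-trans)
open import Algebra.Bundles using (CommutativeRing; Group)
open import Algebra.Properties.CommutativeSemigroup ℕ.*-commutativeSemigroup using (x∙yz≈y∙xz)
import Algebra.Properties.Group as GroupProperties
import Algebra.Solver.Ring as RingSolver
import Algebra.Solver.Ring.AlmostCommutativeRing as ACR
open import Relation.Binary.Construct.Closure.ReflexiveTransitive using (Star; _◅_; _◅◅_; reverse) renaming (ε to done)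
open import Relation.Binary.Definitions using (DecidableEquality)
open import Relation.Binary.PropositionalEquality using (_≡_; _≢_; refl; sym; trans; cong; cong₂; subst; subst₂; isEquivalence; module ≡-Reasoning)
import Relation.Binary.Reasoning.Setoid as SetoidReasoning
open import Relation.Nullary using (¬_; yes; no; does; contradiction)
open import Relation.Nullary.Decidable using (dec-true; dec-false)
open import Relation.Nullary.Decidable.Core using (dec⇒maybe)
open Inverse using (to; from)

-- The shape of the geometry comes from one conjugation rule. Conjugation by σ₁² raises σ₂ to the
-- power 1 - N, so conjugation by σ₁^(2c) raises it to (1 - N)^c = 1 - cN modulo q; hence the shift
-- between the two faces of an edge, while σ₂σ₁ = σ₁⁻¹σ₂⁻¹ yields the second endpoint c - f. For the
-- quadratic action of σ₁, write it as f ↦ -f - e(f) with e a polynomial whose coefficients are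
-- multiples of N. Carrying the two faces of every edge to those of the image edge, in the opposite
-- order, amounts to e(f + 1) - e(f) = fN, and e(0) = 0 because σ₁ fixes the base face; so e is N
-- times a triangular number. Halving N modulo q is possible because m is odd. All twists are
-- multiples of N, and these form an ideal of square zero in ℤ/q. Each verification is therefore a
-- first-order computation: a polynomial identity up to an explicit multiple of a vanishing product.

infix 4 _≡_[mod_]

_≡_[mod_] : ℤ → ℤ → ℕ → Set
a ≡ b [mod n ] = + n ∣ a ℤ.- b

-- The ring ℤ/n on `Fin n`, with a solver over integer coefficients.

module ZMod (n : ℕ) .{{_ : ℕ.NonZero n}} where

  open +-*-Solver using (solve; con; _:=_; _:+_; _:*_; _:-_; :-_)

  ⟦_⟧ : Fin n → ℤ
  ⟦ a ⟧ = + toℕ a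

  opaque
    -- Kept opaque: `⟦[]⟧` is all that is ever used about the chosen representative, so residues
    -- stay symbolic in later goals.
    [_] : ℤ → Fin n
    [ z ] = fromℕ< (n%ℕd<d z n)

    ⟦[]⟧ : ∀ z → z ≡ ⟦ [ z ] ⟧ [mod n ]
    ⟦[]⟧ z = divides (z /ℕ n) (begin
      z ℤ.- ⟦ [ z ] ⟧                        ≡⟨ cong₂ (λ t u → t ℤ.- + u) (a≡a%ℕn+[a/ℕn]*n z n) (Fin.toℕ-fromℕ< (n%ℕd<d z n)) ⟩
      + ρ ℤ.+ (z /ℕ n) ℤ.* + n ℤ.- + ρ        ≡⟨ solve 2 (λ x y → x :+ y :- x := y) refl (+ ρ) ((z /ℕ n) ℤ.* + n) ⟩
      (z /ℕ n) ℤ.* + n                       ∎)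
      where
      open ≡-Reasoning
      ρ : ℕ
      ρ = z ℤ.%ℕ n

  -- Two representatives differ by less than n in absolute value, and the only multiple of n in that
  -- range is 0.
  ⟦⟧-injective : ∀ a b → ⟦ a ⟧ ≡ ⟦ b ⟧ [mod n ] → a ≡ b
  ⟦⟧-injective a b n∣a-b = Fin.toℕ-injective (ℤ.+-injective (ℤ.i-j≡0⇒i≡j ⟦ a ⟧ ⟦ b ⟧ (ℤ.∣i∣≡0⇒i≡0 vanishes)))
    where
    bound : ℤ.∣ ⟦ a ⟧ ℤ.- ⟦ b ⟧ ∣ ℕ.< n
    bound = ℕ.≤-<-trans
      (subst (ℕ._≤ toℕ a ℕ.⊔ toℕ b) (cong ℤ.∣_∣ (sym (ℤ.m-n≡m⊖n (toℕ a) (toℕ b)))) (ℤ.∣m⊝n∣≤m⊔n (toℕ a) (toℕ b)))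
      (ℕ.⊔-pres-<m (Fin.toℕ<n a) (Fin.toℕ<n b))
    vanishes : ℤ.∣ ⟦ a ⟧ ℤ.- ⟦ b ⟧ ∣ ≡ 0
    vanishes with ℤ.∣ ⟦ a ⟧ ℤ.- ⟦ b ⟧ ∣ | bound | ∣⇒∣ᵤ n∣a-b
    ... | zero  | _  | _  = refl
    ... | suc _ | <n | n∣ = contradiction n∣ (ℕ.>⇒∤ <n)

  ⟦⟧-section : ∀ a → [ ⟦ a ⟧ ] ≡ a
  ⟦⟧-section a = sym (⟦⟧-injective a [ ⟦ a ⟧ ] (⟦[]⟧ ⟦ a ⟧))

  []-cong : ∀ {x y} → x ≡ y [mod n ] → [ x ] ≡ [ y ]
  []-cong {x} {y} n∣x-y = ⟦⟧-injective [ x ] [ y ]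
    (subst (+ n ∣_)
      (solve 4 (λ x y u v → (x :- y) :- ((x :- u) :- (y :- v)) := u :- v) refl x y ⟦ [ x ] ⟧ ⟦ [ y ] ⟧)
      (∣m∣n⇒∣m-n n∣x-y (∣m∣n⇒∣m-n (⟦[]⟧ x) (⟦[]⟧ y))))

  []-cancel : ∀ {x y} → [ x ] ≡ [ y ] → x ≡ y [mod n ]
  []-cancel {x} {y} eq =
    subst (+ n ∣_)
      (trans (cong (λ t → (x ℤ.- ⟦ t ⟧) ℤ.- (y ℤ.- ⟦ [ y ] ⟧)) eq)
             (solve 3 (λ x y u → (x :- u) :- (y :- u) := x :- y) refl x y ⟦ [ y ] ⟧))
      (∣m∣n⇒∣m-n (⟦[]⟧ x) (⟦[]⟧ y))

  []≡0⇒∣ : ∀ a → [ + a ] ≡ [ + 0 ] → n ℕ.∣ a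
  []≡0⇒∣ a eq = subst (n ℕ.∣_) (ℕ.+-identityʳ a) (∣⇒∣ᵤ ([]-cancel {+ a} {+ 0} eq))

  infixl 6 _+_
  infixl 7 _*_
  infix  8 -_

  _+_ _*_ : Fin n → Fin n → Fin n
  a + b = [ ⟦ a ⟧ ℤ.+ ⟦ b ⟧ ]
  a * b = [ ⟦ a ⟧ ℤ.* ⟦ b ⟧ ]

  -_ : Fin n → Fin n
  - a = [ ℤ.- ⟦ a ⟧ ]

  +-homo : ∀ x y → [ x ℤ.+ y ] ≡ [ x ] + [ y ]
  +-homo x y = []-cong (subst (+ n ∣_)
    (solve 4 (λ x y u v → (x :- u) :+ (y :- v) := x :+ y :- (u :+ v)) refl x y ⟦ [ x ] ⟧ ⟦ [ y ] ⟧)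
    (∣m∣n⇒∣m+n (⟦[]⟧ x) (⟦[]⟧ y)))

  *-homo : ∀ x y → [ x ℤ.* y ] ≡ [ x ] * [ y ]
  *-homo x y = []-cong (subst (+ n ∣_)
    (solve 4 (λ x y u v → (x :- u) :* y :+ u :* (y :- v) := x :* y :- u :* v) refl x y ⟦ [ x ] ⟧ ⟦ [ y ] ⟧)
    (∣m∣n⇒∣m+n (∣m⇒∣m*n y (⟦[]⟧ x)) (∣n⇒∣m*n ⟦ [ x ] ⟧ (⟦[]⟧ y))))

  -‿homo : ∀ x → [ ℤ.- x ] ≡ - [ x ]
  -‿homo x = []-cong (subst (+ n ∣_)
    (solve 2 (λ x u → :- (x :- u) := :- x :- :- u) refl x ⟦ [ x ] ⟧)
    (∣m⇒∣-m (⟦[]⟧ x)))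

  private
    -- Ring laws descend from ℤ: `via` takes the law for representatives together with the values of
    -- the classes of its two sides, which the bracket combinators assemble from `+-homo` and
    -- `*-homo`.
    via : ∀ {x y} a b → x ≡ y → [ x ] ≡ a → [ y ] ≡ b → a ≡ b
    via a b eq p q = trans (sym p) (trans (cong [_] eq) q)

    ⟨_⟩+⟨_⟩ : ∀ {x y a b} → [ x ] ≡ a → [ y ] ≡ b → [ x ℤ.+ y ] ≡ a + b
    ⟨_⟩+⟨_⟩ {x} {y} refl refl = +-homo x y

    ⟨_⟩*⟨_⟩ : ∀ {x y a b} → [ x ] ≡ a → [ y ] ≡ b → [ x ℤ.* y ] ≡ a * b
    ⟨_⟩*⟨_⟩ {x} {y} refl refl = *-homo x y

    σ = ⟦⟧-section

  commutativeRing : CommutativeRing 0ℓ 0ℓ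
  commutativeRing = record
    { Carrier = Fin n
    ; _≈_ = _≡_
    ; _+_ = _+_
    ; _*_ = _*_
    ; -_  = -_
    ; 0#  = [ + 0 ]
    ; 1#  = [ + 1 ]
    ; isCommutativeRing = record
      { isRing = record
        { +-isAbelianGroup = record
          { isGroup = record
            { isMonoid = record
              { isSemigroup = record
                { isMagma = record { isEquivalence = isEquivalence ; ∙-cong = cong₂ _+_ }
                ; assoc = λ a b c → via _ _ (ℤ.+-assoc ⟦ a ⟧ ⟦ b ⟧ ⟦ c ⟧)
                    ⟨ ⟨ σ a ⟩+⟨ σ b ⟩ ⟩+⟨ σ c ⟩ ⟨ σ a ⟩+⟨ ⟨ σ b ⟩+⟨ σ c ⟩ ⟩
                }
              ; identity = (λ a → via _ _ (ℤ.+-identityˡ ⟦ a ⟧) ⟨ refl ⟩+⟨ σ a ⟩ (σ a))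
                         , (λ a → via _ _ (ℤ.+-identityʳ ⟦ a ⟧) ⟨ σ a ⟩+⟨ refl ⟩ (σ a))
              }
            ; inverse = (λ a → via _ _ (ℤ.+-inverseˡ ⟦ a ⟧) ⟨ refl ⟩+⟨ σ a ⟩ refl)
                      , (λ a → via _ _ (ℤ.+-inverseʳ ⟦ a ⟧) ⟨ σ a ⟩+⟨ refl ⟩ refl)
            ; ⁻¹-cong = cong -_
            }
          ; comm = λ a b → cong [_] (ℤ.+-comm ⟦ a ⟧ ⟦ b ⟧)
          }
        ; *-cong = cong₂ _*_
        ; *-assoc = λ a b c → via _ _ (ℤ.*-assoc ⟦ a ⟧ ⟦ b ⟧ ⟦ c ⟧)
            ⟨ ⟨ σ a ⟩*⟨ σ b ⟩ ⟩*⟨ σ c ⟩ ⟨ σ a ⟩*⟨ ⟨ σ b ⟩*⟨ σ c ⟩ ⟩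
        ; *-identity = (λ a → via _ _ (ℤ.*-identityˡ ⟦ a ⟧) ⟨ refl ⟩*⟨ σ a ⟩ (σ a))
                     , (λ a → via _ _ (ℤ.*-identityʳ ⟦ a ⟧) ⟨ σ a ⟩*⟨ refl ⟩ (σ a))
        ; distrib = (λ a b c → via _ _ (ℤ.*-distribˡ-+ ⟦ a ⟧ ⟦ b ⟧ ⟦ c ⟧)
                      ⟨ σ a ⟩*⟨ ⟨ σ b ⟩+⟨ σ c ⟩ ⟩ ⟨ ⟨ σ a ⟩*⟨ σ b ⟩ ⟩+⟨ ⟨ σ a ⟩*⟨ σ c ⟩ ⟩)
                  , (λ a b c → via _ _ (ℤ.*-distribʳ-+ ⟦ a ⟧ ⟦ b ⟧ ⟦ c ⟧)
                      ⟨ ⟨ σ b ⟩+⟨ σ c ⟩ ⟩*⟨ σ a ⟩ ⟨ ⟨ σ b ⟩*⟨ σ a ⟩ ⟩+⟨ ⟨ σ c ⟩*⟨ σ a ⟩ ⟩)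
        }
      ; *-comm = λ a b → cong [_] (ℤ.*-comm ⟦ a ⟧ ⟦ b ⟧)
      }
    }

  open CommutativeRing commutativeRing public using (_-_)

  private
    target : ACR.AlmostCommutativeRing 0ℓ 0ℓ
    target = ACR.fromCommutativeRing commutativeRing

    reduction : CommutativeRing.rawRing ℤ.+-*-commutativeRing ACR.-Raw-AlmostCommutative⟶ target
    reduction = record
      { ⟦_⟧ = [_] ; +-homo = +-homo ; *-homo = *-homo ; -‿homo = -‿homo
      ; 0-homo = refl ; 1-homo = refl }

  -- Coefficients are integers rather than residues, because integers can be compared by computation
  -- while the classes are opaque.
  module Solver = RingSolver (CommutativeRing.rawRing ℤ.+-*-commutativeRing) target reduction
    (λ x y → Maybe.map (cong [_]) (dec⇒maybe (x ℤ.≟ y)))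

-- Arithmetic of ℤ/m and ℤ/q, and the twisted maps on faces.

module Residues (m L k h : ℕ) .{{_ : ℕ.NonZero m}} .{{_ : ℕ.NonZero (m ℕ.* (m ℕ.* L))}}
                (2h≡1+m : h ℕ.+ h ≡ suc m) where

  q N : ℕ
  q = m ℕ.* (m ℕ.* L)
  N = k ℕ.* (m ℕ.* L)

  module S = ZMod m
  module R = ZMod q
  open R using (_+_; _*_; -_; _-_)

  0S 1S : Fin m
  0S = S.[ + 0 ]
  1S = S.[ + 1 ]

  -- Since 2h ≡ 1 mod m, s is half of r.
  0R 1R r s : Fin q
  0R = R.[ + 0 ]
  1R = R.[ + 1 ]
  r  = R.[ + N ]
  s  = R.[ + h ℤ.* + N ]

  ρ : Fin q → Fin m
  ρ f = S.[ R.⟦ f ⟧ ]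

  κ : Fin m → Fin q
  κ c = R.[ S.⟦ c ⟧ ℤ.* + N ]

  ρ-[] : ∀ z → ρ R.[ z ] ≡ S.[ z ]
  ρ-[] z = sym (S.[]-cong (∣-trans m∣q (R.⟦[]⟧ z)))
    where
    m∣q : + m ∣ + q
    m∣q = divides (+ (m ℕ.* L)) (trans (ℤ.pos-* m (m ℕ.* L)) (ℤ.*-comm (+ m) _))

  -- Since mN = kq, the multiple zN modulo q depends only on z modulo m.
  κ-[] : ∀ z → κ S.[ z ] ≡ R.[ z ℤ.* + N ]
  κ-[] z with S.⟦[]⟧ z
  ... | divides t eq = sym (R.[]-cong (divides (t ℤ.* + k) (begin
    z ℤ.* + N ℤ.- S.⟦ S.[ z ] ⟧ ℤ.* + N      ≡⟨ solve 3 (λ a b c → a :* c :- b :* c := (a :- b) :* c) refl z S.⟦ S.[ z ] ⟧ (+ N) ⟩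
    (z ℤ.- S.⟦ S.[ z ] ⟧) ℤ.* + N            ≡⟨ cong (ℤ._* + N) eq ⟩
    t ℤ.* + m ℤ.* + N                        ≡⟨ cong (t ℤ.* + m ℤ.*_) (ℤ.pos-* k (m ℕ.* L)) ⟩
    t ℤ.* + m ℤ.* (+ k ℤ.* + (m ℕ.* L))      ≡⟨ solve 4 (λ t m k l → t :* m :* (k :* l) := t :* k :* (m :* l)) refl t (+ m) (+ k) (+ (m ℕ.* L)) ⟩
    t ℤ.* + k ℤ.* (+ m ℤ.* + (m ℕ.* L))      ≡⟨ cong (t ℤ.* + k ℤ.*_) (ℤ.pos-* m (m ℕ.* L)) ⟨
    t ℤ.* + k ℤ.* + q                        ∎)))
    where
    open ≡-Reasoning
    open +-*-Solver

  ρ-+ : ∀ f g → ρ (f + g) ≡ ρ f S.+ ρ g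
  ρ-+ f g = trans (ρ-[] _) (S.+-homo _ _)

  ρ-neg : ∀ f → ρ (- f) ≡ S.- ρ f
  ρ-neg f = trans (ρ-[] _) (S.-‿homo _)

  ρ-* : ∀ f g → ρ (f * g) ≡ ρ f S.* ρ g
  ρ-* f g = trans (ρ-[] _) (S.*-homo _ _)

  ρ-minus : ∀ f g → ρ (f - g) ≡ ρ f S.- ρ g
  ρ-minus f g = trans (ρ-+ f (- g)) (cong (ρ f S.+_) (ρ-neg g))

  κ-+ : ∀ c d → κ (c S.+ d) ≡ κ c + κ d
  κ-+ c d = trans (κ-[] _) (trans (cong R.[_] (ℤ.*-distribʳ-+ (+ N) S.⟦ c ⟧ S.⟦ d ⟧)) (R.+-homo _ _))

  κ-neg : ∀ c → κ (S.- c) ≡ - κ c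
  κ-neg c = trans (κ-[] _) (trans (cong R.[_] (sym (ℤ.neg-distribˡ-* S.⟦ c ⟧ (+ N)))) (R.-‿homo _))

  κ-minus : ∀ c d → κ (c S.- d) ≡ κ c - κ d
  κ-minus c d = trans (κ-+ c (S.- d)) (cong (_+_ (κ c)) (κ-neg d))

  κ-ρ : ∀ f → κ (ρ f) ≡ f * r
  κ-ρ f = trans (κ-[] _) (trans (R.*-homo _ _) (cong (_* r) (R.⟦⟧-section f)))

  κ-0 : κ 0S ≡ 0R
  κ-0 = κ-[] (+ 0)

  κ-1 : κ 1S ≡ r
  κ-1 = trans (κ-[] (+ 1)) (cong R.[_] (ℤ.*-identityˡ (+ N)))

  r≡s+s : r ≡ s + s
  r≡s+s = sym (trans (sym (R.+-homo _ _)) (R.[]-cong (divides (+ k) (begin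
    + h ℤ.* + N ℤ.+ + h ℤ.* + N ℤ.- + N      ≡⟨ solve 2 (λ h n → h :* n :+ h :* n :- n := (h :+ h :- con (+ 1)) :* n) refl (+ h) (+ N) ⟩
    (+ h ℤ.+ + h ℤ.- + 1) ℤ.* + N            ≡⟨ cong (λ x → (+ x ℤ.- + 1) ℤ.* + N) 2h≡1+m ⟩
    + m ℤ.* + N                              ≡⟨ cong (+ m ℤ.*_) (ℤ.pos-* k (m ℕ.* L)) ⟩
    + m ℤ.* (+ k ℤ.* + (m ℕ.* L))            ≡⟨ solve 3 (λ m k l → m :* (k :* l) := k :* (m :* l)) refl (+ m) (+ k) (+ (m ℕ.* L)) ⟩
    + k ℤ.* (+ m ℤ.* + (m ℕ.* L))            ≡⟨ cong (+ k ℤ.*_) (ℤ.pos-* m (m ℕ.* L)) ⟨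
    + k ℤ.* + q                              ∎))))
    where
    open ≡-Reasoning
    open +-*-Solver

  -- N² = k²m²L² = k²L · q: this is the source of every vanishing product below, and it relies on q
  -- containing the factor m twice.
  multiples-of-N-null : ∀ x y → R.[ x ℤ.* + N ] * R.[ y ℤ.* + N ] ≡ 0R
  multiples-of-N-null x y = trans (sym (R.*-homo _ _)) (R.[]-cong (divides (x ℤ.* y ℤ.* + k ℤ.* + k ℤ.* + L) (begin
    x ℤ.* + N ℤ.* (y ℤ.* + N) ℤ.- + 0
      ≡⟨ cong (λ n → x ℤ.* n ℤ.* (y ℤ.* n) ℤ.- + 0) (trans (ℤ.pos-* k (m ℕ.* L)) (cong (+ k ℤ.*_) (ℤ.pos-* m L))) ⟩
    x ℤ.* (+ k ℤ.* (+ m ℤ.* + L)) ℤ.* (y ℤ.* (+ k ℤ.* (+ m ℤ.* + L))) ℤ.- + 0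
      ≡⟨ solve 5 (λ x y k m l → x :* (k :* (m :* l)) :* (y :* (k :* (m :* l))) :- con (+ 0)
                  := x :* y :* k :* k :* l :* (m :* (m :* l))) refl x y (+ k) (+ m) (+ L) ⟩
    x ℤ.* y ℤ.* + k ℤ.* + k ℤ.* + L ℤ.* (+ m ℤ.* (+ m ℤ.* + L))
      ≡⟨ cong (x ℤ.* y ℤ.* + k ℤ.* + k ℤ.* + L ℤ.*_) (trans (ℤ.pos-* m (m ℕ.* L)) (cong (+ m ℤ.*_) (ℤ.pos-* m L))) ⟨
    x ℤ.* y ℤ.* + k ℤ.* + k ℤ.* + L ℤ.* + q ∎)))
    where
    open ≡-Reasoning
    open +-*-Solver

  ss≡0 : s * s ≡ 0R
  ss≡0 = multiples-of-N-null (+ h) (+ h)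

  sκ≡0 : ∀ c → s * κ c ≡ 0R
  sκ≡0 c = multiples-of-N-null (+ h) S.⟦ c ⟧

  κκ≡0 : ∀ c d → κ c * κ d ≡ 0R
  κκ≡0 c d = multiples-of-N-null S.⟦ c ⟧ S.⟦ d ⟧

  ρ-N≡0 : ∀ x → ρ R.[ x ℤ.* + N ] ≡ 0S
  ρ-N≡0 x = trans (ρ-[] _) (S.[]-cong (divides (x ℤ.* + k ℤ.* + L) (begin
    x ℤ.* + N ℤ.- + 0                        ≡⟨ cong (λ n → x ℤ.* n ℤ.- + 0) (trans (ℤ.pos-* k (m ℕ.* L)) (cong (+ k ℤ.*_) (ℤ.pos-* m L))) ⟩
    x ℤ.* (+ k ℤ.* (+ m ℤ.* + L)) ℤ.- + 0    ≡⟨ solve 4 (λ x k m l → x :* (k :* (m :* l)) :- con (+ 0) := x :* k :* l :* m) refl x (+ k) (+ m) (+ L) ⟩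
    x ℤ.* + k ℤ.* + L ℤ.* + m                ∎)))
    where
    open ≡-Reasoning
    open +-*-Solver

  -- Modulo s², the inverse of f ↦ -f - e(f) is f ↦ -f - e(-f); for e(f) = s · f · (f - 1) this
  -- replaces f - 1 by f + 1.
  φ ψ : Fin q → Fin q
  φ f = - f - s * (f * (f - 1R))
  ψ f = - f - s * (f * (f + 1R))

  open R.Solver

  -- The pattern of the verifications that follow: the solver proves an identity with an explicit
  -- cofactor of `s * s`, `s * κ c` or `κ c * κ d`, and that term is then discarded.
  absorb : ∀ {a z p} → z ≡ 0R → a + z * p ≡ a
  absorb {a} {p = p} refl = solve 2 (λ a p → a :+ con (+ 0) :* p := a) refl a p

  ρ-twist : ∀ f g → ρ (- f - s * g) ≡ S.- ρ f
  ρ-twist f g = begin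
    ρ (- f - s * g)               ≡⟨ ρ-minus (- f) (s * g) ⟩
    ρ (- f) S.- ρ (s * g)         ≡⟨ cong₂ S._-_ (ρ-neg f) (trans (ρ-* s g) (cong (S._* ρ g) (ρ-N≡0 (+ h)))) ⟩
    S.- ρ f S.- 0S S.* ρ g        ≡⟨ S.Solver.solve 2 (λ f y → Sv.:- f Sv.:- Sv.con (+ 0) Sv.:* y Sv.:= Sv.:- f) refl (ρ f) (ρ g) ⟩
    S.- ρ f                       ∎
    where
    open ≡-Reasoning
    module Sv = S.Solver

  ρφ : ∀ f → ρ (φ f) ≡ S.- ρ f
  ρφ f = ρ-twist f (f * (f - 1R))

  ρψ : ∀ f → ρ (ψ f) ≡ S.- ρ f
  ρψ f = ρ-twist f (f * (f + 1R))

  φψ : ∀ f → φ (ψ f) ≡ f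
  φψ f = trans
    (solve 2 (λ f s → let w = f :* (f :+ con (+ 1)); g = :- f :- s :* w in
      :- g :- s :* (g :* (g :- con (+ 1)))
      := f :+ s :* s :* (:- (w :* (f :+ f :+ con (+ 1)) :+ s :* (w :* w)))) refl f s)
    (absorb ss≡0)

  ψφ : ∀ f → ψ (φ f) ≡ f
  ψφ f = trans
    (solve 2 (λ f s → let w = f :* (f :- con (+ 1)); g = :- f :- s :* w in
      :- g :- s :* (g :* (g :+ con (+ 1)))
      := f :+ s :* s :* (:- (w :* (f :+ f :- con (+ 1)) :+ s :* (w :* w)))) refl f s)
    (absorb ss≡0)

  φφ : ∀ f → φ (φ f) ≡ f - r * f
  φφ f = trans (trans
    (solve 2 (λ f s → let w = f :* (f :- con (+ 1)); g = :- f :- s :* w in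
      :- g :- s :* (g :* (g :- con (+ 1)))
      := f :- (s :+ s) :* f :+ s :* s :* (:- (w :* (f :+ f :+ con (+ 1)) :+ s :* (w :* w)))) refl f s)
    (absorb ss≡0)) (cong (λ x → f - x * f) (sym r≡s+s))

  -- This is the difference equation that determines `φ`. Here c - ρ f is the first endpoint of the
  -- image of the edge (c , f) under σ₁, so the left side is the second face of that image. `ψ-step`
  -- is the same for σ₁⁻¹, whose image edge has first endpoint c - ρ f - 1.
  φ-step : ∀ c f → φ (f + (1R - κ c)) + (1R - κ (c S.- ρ f)) ≡ φ f
  φ-step c f = trans
    (cong (λ x → φ (f + (1R - κ c)) + (1R - x))
      (trans (κ-minus c (ρ f)) (cong (_-_ (κ c)) (trans (κ-ρ f) (cong (f *_) r≡s+s)))))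
    (trans
      (solve 3 (λ f s K → let g = f :+ (con (+ 1) :- K) in
        :- g :- s :* (g :* (g :- con (+ 1))) :+ (con (+ 1) :- (K :- f :* (s :+ s)))
        := :- f :- s :* (f :* (f :- con (+ 1))) :+ s :* K :* (f :+ f :+ con (+ 1) :- K)) refl f s (κ c))
      (absorb (sκ≡0 c)))

  ψ-step : ∀ c f → ψ (f + (1R - κ c)) + (1R - κ (c S.- ρ f S.- 1S)) ≡ ψ f
  ψ-step c f = trans
    (cong (λ x → ψ (f + (1R - κ c)) + (1R - x))
      (trans (κ-minus (c S.- ρ f) 1S) (cong₂ _-_
        (trans (κ-minus c (ρ f)) (cong (_-_ (κ c)) (trans (κ-ρ f) (cong (f *_) r≡s+s))))
        (trans κ-1 r≡s+s))))
    (trans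
      (solve 3 (λ f s K → let g = f :+ (con (+ 1) :- K) in
        :- g :- s :* (g :* (g :+ con (+ 1))) :+ (con (+ 1) :- (K :- f :* (s :+ s) :- (s :+ s)))
        := :- f :- s :* (f :* (f :+ con (+ 1))) :+ s :* K :* (f :+ f :+ con (+ 3) :- K)) refl f s (κ c))
      (absorb (sκ≡0 c)))

  [suc] : ∀ n → R.[ + suc n ] ≡ R.[ + n ] + 1R
  [suc] n = trans (cong (λ x → R.[ + x ]) (ℕ.+-comm 1 n)) (R.+-homo (+ n) (+ 1))

  -- Closed forms for the n-th iterate at 0 of f ↦ f + (1 − κ c) and of
  -- f ↦ f + (1 − κ (d + ρ f)), the rotations of the faces about a vertex of either copy.
  turn₀ turn₁ : Fin m → Fin q → Fin q
  turn₀ c n = n * (1R - κ c)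
  turn₁ d n = n * (1R - κ d) - s * (n * (n - 1R))

  turn₀-suc : ∀ c n → turn₀ c (n + 1R) ≡ turn₀ c n + (1R - κ c)
  turn₀-suc c n = solve 2 (λ K n → (n :+ con (+ 1)) :* (con (+ 1) :- K) := n :* (con (+ 1) :- K) :+ (con (+ 1) :- K)) refl (κ c) n

  turn₁-suc : ∀ d n → turn₁ d (n + 1R) ≡ turn₁ d n + (1R - κ (d S.+ ρ (turn₁ d n)))
  turn₁-suc d n = sym (trans
    (cong (λ x → turn₁ d n + (1R - x))
      (trans (κ-+ d _) (cong (_+_ (κ d)) (trans (κ-ρ (turn₁ d n)) (cong (turn₁ d n *_) r≡s+s)))))
    (trans
      (solve 3 (λ K s n → let t = n :* (con (+ 1) :- K) :- s :* (n :* (n :- con (+ 1))) in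
        t :+ (con (+ 1) :- (K :+ t :* (s :+ s)))
        := (n :+ con (+ 1)) :* (con (+ 1) :- K) :- s :* ((n :+ con (+ 1)) :* (n :+ con (+ 1) :- con (+ 1)))
           :+ s :* K :* (n :+ n) :+ s :* s :* ((n :+ n) :* (n :- con (+ 1)))) refl (κ d) s n)
      (trans (absorb ss≡0) (absorb (sκ≡0 d)))))

  -- Right inverses to first order in N: the number of turns about the vertex that bring face 0 to
  -- f. Their existence shows that the faces around a vertex form a single orbit.
  unturn₀ unturn₁ : Fin m → Fin q → Fin q
  unturn₀ c f = f * (1R + κ c)
  unturn₁ d f = f + (f * κ d + s * (f * (f - 1R)))

  turn₀-unturn₀ : ∀ c f → turn₀ c (unturn₀ c f) ≡ f
  turn₀-unturn₀ c f = trans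
    (solve 2 (λ K f → f :* (con (+ 1) :+ K) :* (con (+ 1) :- K) := f :+ K :* K :* (:- f)) refl (κ c) f)
    (absorb (κκ≡0 c c))

  turn₁-unturn₁ : ∀ d f → turn₁ d (unturn₁ d f) ≡ f
  turn₁-unturn₁ d f = trans
    (solve 3 (λ K s f → let w = f :* (f :- con (+ 1)); δ = f :* K :+ s :* w; n = f :+ δ
                            u = f :+ f :- con (+ 1) :+ δ in
      n :* (con (+ 1) :- K) :- s :* (n :* (n :- con (+ 1)))
      := f :+ K :* K :* (:- f) :+ s :* K :* (:- w :- f :* u) :+ s :* s :* (:- (w :* u))) refl (κ d) s f)
    (trans (absorb ss≡0) (trans (absorb (sκ≡0 d)) (absorb (κκ≡0 d d))))

  ψψ : ∀ f → ψ (ψ f) ≡ f + r * f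
  ψψ f = trans (trans
    (solve 2 (λ f s → let w = f :* (f :+ con (+ 1)); g = :- f :- s :* w in
      :- g :- s :* (g :* (g :+ con (+ 1)))
      := f :+ (s :+ s) :* f :+ s :* s :* (:- (w :* (f :+ f :- con (+ 1)) :+ s :* (w :* w)))) refl f s)
    (absorb ss≡0)) (cong (λ x → f + x * f) (sym r≡s+s))

-- Incidence tests with two candidates, and general facts on ranked posets.

module _ {A : Set} (_≟_ : DecidableEquality A) where

  among : A → (Bool → A) → Bool
  among a g = does (a ≟ g false) ∨ does (a ≟ g true)

  among-sound : ∀ a g → among a g ≡ true → ∃ λ i → a ≡ g i
  among-sound a g p with a ≟ g false | a ≟ g true
  ... | yes eq | _      = false , eq
  ... | no _   | yes eq = true , eq

  among-complete : ∀ a g i → a ≡ g i → among a g ≡ true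
  among-complete a g false eq rewrite dec-true (a ≟ g false) eq = refl
  among-complete a g true  eq rewrite dec-true (a ≟ g true) eq = Bool.∨-zeroʳ _

same-or-not : ∀ a b → a ≡ b ⊎ a ≡ not b
same-or-not false false = inj₁ refl
same-or-not false true  = inj₂ refl
same-or-not true  false = inj₂ refl
same-or-not true  true  = inj₁ refl

not≢ : ∀ {b} → not b ≢ b
not≢ {false} ()
not≢ {true}  ()

Σ↔ : {A B : Set} {P : A → Set} → (∀ {a} (p p′ : P a) → p ≡ p′) →
     (to : A → B) (from : B → A) → (∀ b → P (from b)) →
     (∀ b → to (from b) ≡ b) → (∀ a → P a → from (to a) ≡ a) → Σ A P ↔ B
Σ↔ {A} {B} {P} irr to from ok to-from from-to =
  mk↔ₛ′ (λ x → to (proj₁ x)) (λ b → from b , ok b) to-from (λ x → eq (from-to (proj₁ x) (proj₂ x)))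
  where
  eq : {x y : Σ A P} → proj₁ x ≡ proj₁ y → x ≡ y
  eq {_ , p} {_ , p′} refl = cong (_ ,_) (irr p p′)

module _ (P : RankedPoset) where
  open RankedPoset P

  Inc-sym : ∀ {x y} → Inc x y → Inc y x
  Inc-sym {inj₁ _}        {inj₂ (inj₁ _)} p = p
  Inc-sym {inj₁ _}        {inj₂ (inj₂ _)} p = p
  Inc-sym {inj₂ (inj₁ _)} {inj₁ _}        p = p
  Inc-sym {inj₂ (inj₁ _)} {inj₂ (inj₂ _)} p = p
  Inc-sym {inj₂ (inj₂ _)} {inj₁ _}        p = p
  Inc-sym {inj₂ (inj₂ _)} {inj₂ (inj₁ _)} p = p

  hub⇒connected : ∀ {X : Elt → Set} (hub : Σ Elt X) →
    (∀ x → Star (λ (a b : Σ Elt X) → Inc (proj₁ a) (proj₁ b)) x hub) → InducedConnected X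
  hub⇒connected hub path x y = path x ◅◅ reverse (λ {a} {b} → Inc-sym {proj₁ a} {proj₁ b}) (path y)

  Flag-ext : ∀ {Φ Ψ : Flag} → fv Φ ≡ fv Ψ → fe Φ ≡ fe Ψ → ff Φ ≡ ff Ψ → Φ ≡ Ψ
  Flag-ext {flag v e f p₁ p₂ p₃} {flag _ _ _ p₁′ p₂′ p₃′} refl refl refl
    with uip p₁ p₁′ | uip p₂ p₂′ | uip p₃ p₃′
  ... | refl | refl | refl = refl

to-injective : {A B : Set} (i : A ↔ B) → ∀ {x y} → to i x ≡ to i y → x ≡ y
to-injective i {x} {y} eq = trans (sym (Inverse.strictlyInverseʳ i x))
  (trans (cong (from i) eq) (Inverse.strictlyInverseʳ i y))

-- The map τ records what happens to the labels `false` and `true` of the two incident elements: σ₁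
-- exchanges them (`not`), σ₂ keeps them.
among-transport : {A : Set} (_≟_ : DecidableEquality A) (α : A ↔ A) (τ : Bool → Bool) → (∀ i → τ (τ i) ≡ i) →
  (g g′ : Bool → A) → (∀ i → g′ i ≡ to α (g (τ i))) → ∀ a → among _≟_ (to α a) g′ ≡ among _≟_ a g
among-transport _≟_ α τ ττ g g′ τ-α a = Bool.⇔→≡ {z = true} (mk⇔
  (λ p → let i , eq = among-sound _≟_ (to α a) g′ p in
    among-complete _≟_ a g (τ i) (to-injective α (trans eq (τ-α i))))
  (λ p → let i , eq = among-sound _≟_ a g p in
    among-complete _≟_ (to α a) g′ (τ i)
      (trans (cong (to α) (trans eq (cong g (sym (ττ i))))) (sym (τ-α (τ i))))))

module _ (P : RankedPoset) where
  open RankedPoset P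

  idAut : Aut
  idAut = record { autV = ↔-refl ; autE = ↔-refl ; autF = ↔-refl
    ; pres-VE = λ _ _ → refl ; pres-EF = λ _ _ → refl ; pres-VF = λ _ _ → refl }

  infixr 9 _∘Aut_

  _∘Aut_ : Aut → Aut → Aut
  α ∘Aut β = record
    { autV = ↔-trans B.autV A.autV ; autE = ↔-trans B.autE A.autE ; autF = ↔-trans B.autF A.autF
    ; pres-VE = λ v e → trans (A.pres-VE _ _) (B.pres-VE v e)
    ; pres-EF = λ e f → trans (A.pres-EF _ _) (B.pres-EF e f)
    ; pres-VF = λ v f → trans (A.pres-VF _ _) (B.pres-VF v f) }
    where
    module A = Aut α
    module B = Aut β

  invAut : Aut → Aut
  invAut α = record
    { autV = ↔-sym A.autV ; autE = ↔-sym A.autE ; autF = ↔-sym A.autF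
    ; pres-VE = λ v e → trans (sym (A.pres-VE _ _)) (cong₂ IVE (Inverse.strictlyInverseˡ A.autV v) (Inverse.strictlyInverseˡ A.autE e))
    ; pres-EF = λ e f → trans (sym (A.pres-EF _ _)) (cong₂ IEF (Inverse.strictlyInverseˡ A.autE e) (Inverse.strictlyInverseˡ A.autF f))
    ; pres-VF = λ v f → trans (sym (A.pres-VF _ _)) (cong₂ IVF (Inverse.strictlyInverseˡ A.autV v) (Inverse.strictlyInverseˡ A.autF f)) }
    where module A = Aut α

  module _ (s₁ s₂ : Aut) where

    evalAut : Word → Aut
    evalAut σ₁      = s₁
    evalAut σ₂      = s₂
    evalAut ε       = idAut
    evalAut (u · w) = evalAut u ∘Aut evalAut w
    evalAut (w ⁻¹)  = invAut (evalAut w)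

    toMaps-evalAut  : ∀ w → toMaps (evalAut w) ≡ eval s₁ s₂ w
    invMaps-evalAut : ∀ w → invMaps (evalAut w) ≡ evalInv s₁ s₂ w

    toMaps-evalAut σ₁      = refl
    toMaps-evalAut σ₂      = refl
    toMaps-evalAut ε       = refl
    toMaps-evalAut (u · w) = cong₂ comp (toMaps-evalAut u) (toMaps-evalAut w)
    toMaps-evalAut (w ⁻¹)  = invMaps-evalAut w

    invMaps-evalAut σ₁      = refl
    invMaps-evalAut σ₂      = refl
    invMaps-evalAut ε       = refl
    invMaps-evalAut (u · w) = cong₂ comp (invMaps-evalAut w) (invMaps-evalAut u)
    invMaps-evalAut (w ⁻¹)  = toMaps-evalAut w

  ≐-trans : ∀ f g h → f ≐ g → g ≐ h → f ≐ h
  ≐-trans _ _ _ (a , b , c) (a′ , b′ , c′) = (λ v → trans (a v) (a′ v)) , (λ e → trans (b e) (b′ e)) , (λ f → trans (c f) (c′ f))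

  ≐-sym : ∀ f g → f ≐ g → g ≐ f
  ≐-sym _ _ (a , b , c) = (λ v → sym (a v)) , (λ e → sym (b e)) , (λ f → sym (c f))

  ≐-refl : ∀ f → f ≐ f
  ≐-refl _ = (λ _ → refl) , (λ _ → refl) , (λ _ → refl)

  comp-cong : ∀ f f′ g g′ → f ≐ f′ → g ≐ g′ → comp f g ≐ comp f′ g′
  comp-cong f f′ _ _ (a , b , c) (a′ , b′ , c′) =
    (λ v → trans (cong (Maps.mV f) (a′ v)) (a _)) , (λ e → trans (cong (Maps.mE f) (b′ e)) (b _)) ,
    (λ x → trans (cong (Maps.mF f) (c′ x)) (c _))

  invMaps-cong : ∀ α β → toMaps α ≐ toMaps β → invMaps α ≐ invMaps β
  invMaps-cong α β (a , b , c) = from-cong A.autV B.autV a , from-cong A.autE B.autE b , from-cong A.autF B.autF c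
    where
    module A = Aut α
    module B = Aut β
    from-cong : {X : Set} (i j : X ↔ X) → (∀ x → to i x ≡ to j x) → ∀ x → from i x ≡ from j x
    from-cong i j eq x = to-injective i (trans (Inverse.strictlyInverseˡ i x)
      (sym (trans (eq _) (Inverse.strictlyInverseˡ j x))))

xor-cancelˡ : ∀ a {b b′} → a xor b ≡ a xor b′ → b ≡ b′
xor-cancelˡ false eq = eq
xor-cancelˡ true  eq = Bool.not-injective eq

xor-cancelʳ : ∀ {a a′} b → a xor b ≡ a′ xor b → a ≡ a′
xor-cancelʳ {a} {a′} b eq = xor-cancelˡ b (trans (Bool.xor-comm b a) (trans eq (Bool.xor-comm a′ b)))

even-or-odd : ∀ a → ∃ λ c → a ≡ 2 ℕ.* c ⊎ a ≡ suc (2 ℕ.* c)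
even-or-odd zero = 0 , inj₁ refl
even-or-odd (suc a) with even-or-odd a
... | c , inj₁ eq = c , inj₂ (cong suc eq)
... | c , inj₂ eq = suc c , inj₁ (trans (cong suc eq) (sym (ℕ.*-suc 2 c)))

-- The coset geometry is a tight polyhedron.

module Polyhedron (m L k h : ℕ) .{{m≢0 : ℕ.NonZero m}} .{{q≢0 : ℕ.NonZero (m ℕ.* (m ℕ.* L))}}
                  (2h≡1+m : h ℕ.+ h ≡ suc m) (1<m : 1 ℕ.< m) where

  open Residues m L k h 2h≡1+m public
  open R using (_+_; _*_; -_; _-_)

  -- (false , c), (true , d) and f stand for the cosets σ₁^(2c)⟨σ₂⟩, σ₁^(2d−1)⟨σ₂⟩ and
  -- σ₂^f⟨σ₁⟩; the edge (c , f) is the coset of ⟨σ₂σ₁⟩ containing σ₂^f σ₁^(2c).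
  V E F : Set
  V = Bool × Fin m
  E = Fin m × Fin q
  F = Fin q

  idx : Bool → E → Fin m
  idx false (c , f) = c
  idx true  (c , f) = c S.- ρ f

  vtx : Bool → E → V
  vtx i e = i , idx i e

  fac : Bool → E → F
  fac false (c , f) = f
  fac true  (c , f) = f + (1R - κ c)

  -- edgeAt v f j is the edge at the vertex v whose j-th face is f.
  edgeAt : V → F → Bool → E
  edgeAt (false , c) f false = c , f
  edgeAt (false , c) f true  = c , f - (1R - κ c)
  edgeAt (true  , d) f false = d S.+ ρ f , f
  -- If g is the other face, then c - ρ g = d, and ρ g = ρ f - 1 by `ρ-fac`. So c can be found from
  -- f before g is known.
  edgeAt (true  , d) f true  = let c = d S.+ ρ f S.- 1S in c , f - (1R - κ c)

  -- The twist κ c is divisible by m, so crossing any edge advances the face by exactly 1 modulo m.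
  -- This separates the two faces of an edge and makes the second endpoint computable from either
  -- face.
  ρ-fac : ∀ e → ρ (fac true e) ≡ ρ (fac false e) S.+ 1S
  ρ-fac (c , f) = begin
    ρ (f + (1R - κ c))                ≡⟨ ρ-+ f _ ⟩
    ρ f S.+ ρ (1R - κ c)              ≡⟨ cong (ρ f S.+_) (ρ-minus 1R (κ c)) ⟩
    ρ f S.+ (ρ 1R S.- ρ (κ c))        ≡⟨ cong₂ (λ a b → ρ f S.+ (a S.- b)) (ρ-[] (+ 1)) (ρ-N≡0 S.⟦ c ⟧) ⟩
    ρ f S.+ (1S S.- 0S)               ≡⟨ solve 1 (λ x → x :+ (con (+ 1) :- con (+ 0)) := x :+ con (+ 1)) refl (ρ f) ⟩
    ρ f S.+ 1S                        ∎
    where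
    open ≡-Reasoning
    open S.Solver

  1S≢0S : 1S ≢ 0S
  1S≢0S eq = contradiction (S.[]≡0⇒∣ 1 eq) (ℕ.>⇒∤ 1<m)

  fac-distinct : ∀ e → fac false e ≢ fac true e
  fac-distinct e eq = 1S≢0S (begin
    1S                            ≡⟨ solve 1 (λ x → con (+ 1) := x :+ con (+ 1) :- x) refl x ⟩
    x S.+ 1S S.- x                ≡⟨ cong (S._- x) (ρ-fac e) ⟨
    ρ (fac true e) S.- x          ≡⟨ cong (λ y → ρ y S.- x) eq ⟨
    x S.- x                       ≡⟨ solve 1 (λ x → x :- x := con (+ 0)) refl x ⟩
    0S                            ∎)
    where
    open ≡-Reasoning
    open S.Solver
    x = ρ (fac false e)

  fac-injective : ∀ i j e → fac i e ≡ fac j e → i ≡ j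
  fac-injective false false e eq = refl
  fac-injective false true  e eq = contradiction eq (fac-distinct e)
  fac-injective true false e eq = contradiction (sym eq) (fac-distinct e)
  fac-injective true true e eq = refl

  private
    cancel : ∀ f t → f - t + t ≡ f
    cancel = solve 2 (λ f t → f :- t :+ t := f) refl
      where open R.Solver

    cancel′ : ∀ f t → f + t - t ≡ f
    cancel′ = solve 2 (λ f t → f :+ t :- t := f) refl
      where open R.Solver

  fac-edgeAt : ∀ v f j → fac j (edgeAt v f j) ≡ f
  fac-edgeAt (false , c) f false = refl
  fac-edgeAt (false , c) f true  = cancel f _
  fac-edgeAt (true  , d) f false = refl
  fac-edgeAt (true  , d) f true  = cancel f _

  vtx-edgeAt : ∀ v f j → vtx (proj₁ v) (edgeAt v f j) ≡ v
  vtx-edgeAt (false , c) f false = refl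
  vtx-edgeAt (false , c) f true  = refl
  vtx-edgeAt (true  , d) f false = cong (true ,_) (solve 2 (λ d x → d :+ x :- x := d) refl d (ρ f))
    where open S.Solver
  vtx-edgeAt (true  , d) f true  = cong (true ,_) (begin
    d S.+ ρ f S.- 1S S.- ρ f′                  ≡⟨ cong (λ x → d S.+ ρ x S.- 1S S.- ρ f′) (fac-edgeAt (true , d) f true) ⟨
    d S.+ ρ (fac true e) S.- 1S S.- ρ f′       ≡⟨ cong (λ x → d S.+ x S.- 1S S.- ρ f′) (ρ-fac e) ⟩
    d S.+ (ρ f′ S.+ 1S) S.- 1S S.- ρ f′        ≡⟨ solve 2 (λ d x → d :+ (x :+ con (+ 1)) :- con (+ 1) :- x := d) refl d (ρ f′) ⟩
    d                                          ∎)
    where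
    open ≡-Reasoning
    open S.Solver
    e = edgeAt (true , d) f true
    f′ = fac false e

  -- Together with `vtx-edgeAt` and `fac-edgeAt` this identifies an edge with chosen labels i, j
  -- with a vertex, a face and the label j. The diamond condition, the type and the flag count are
  -- all read off from this bijection.
  edgeAt-unique : ∀ i j e → edgeAt (vtx i e) (fac j e) j ≡ e
  edgeAt-unique false false (c , f) = refl
  edgeAt-unique false true  (c , f) = cong (c ,_) (cancel′ f _)
  edgeAt-unique true  false (c , f) = cong (_, f) (solve 2 (λ c x → c :- x :+ x := c) refl c (ρ f))
    where open S.Solver
  edgeAt-unique true  true  (c , f) = begin
    back (c S.- ρ f S.+ ρ g S.- 1S)     ≡⟨ cong back (trans (cong (λ x → c S.- ρ f S.+ x S.- 1S) (ρ-fac (c , f)))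
                                            (solve 2 (λ c x → c :- x :+ (x :+ con (+ 1)) :- con (+ 1) := c) refl c (ρ f))) ⟩
    back c                              ≡⟨ cong (c ,_) (cancel′ f _) ⟩
    c , f                               ∎
    where
    open ≡-Reasoning
    open S.Solver
    g = fac true (c , f)
    back : Fin m → E
    back x = x , g - (1R - κ x)

  _≟V_ : DecidableEquality V
  _≟V_ = ≡-dec Bool._≟_ Fin._≟_

  polyhedron : RankedPoset
  polyhedron = record
    { V = V ; E = E ; F = F
    ; IVE = λ v e → among _≟V_ v (λ i → vtx i e)
    ; IEF = λ e f → among Fin._≟_ f (λ j → fac j e)
    ; IVF = λ _ _ → true
    ; ive-ief⇒ivf = λ _ _ → refl
    }

  open RankedPoset polyhedron hiding (V; E; F)

  vtx-inc : ∀ i e → IVE (vtx i e) e ≡ true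
  vtx-inc i e = among-complete _≟V_ (vtx i e) (λ i → vtx i e) i refl

  fac-inc : ∀ j e → IEF e (fac j e) ≡ true
  fac-inc j e = among-complete Fin._≟_ (fac j e) (λ j → fac j e) j refl

  inc-vtx : ∀ v e → IVE v e ≡ true → v ≡ vtx (proj₁ v) e
  inc-vtx v e p with i , refl ← among-sound _≟V_ v (λ i → vtx i e) p = refl

  edgeAt-vtx : ∀ v f j → IVE v (edgeAt v f j) ≡ true
  edgeAt-vtx v f j = among-complete _≟V_ v (λ i → vtx i (edgeAt v f j)) (proj₁ v) (sym (vtx-edgeAt v f j))

  edgeAt-fac : ∀ v f j → IEF (edgeAt v f j) f ≡ true
  edgeAt-fac v f j = among-complete Fin._≟_ f (λ i → fac i (edgeAt v f j)) j (sym (fac-edgeAt v f j))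

  side : E → F → Bool
  side e f = does (f Fin.≟ fac true e)

  side-fac : ∀ e j → side e (fac j e) ≡ j
  side-fac e false = dec-false (fac false e Fin.≟ fac true e) (fac-distinct e)
  side-fac e true  = dec-true (fac true e Fin.≟ fac true e) refl

  inc-fac : ∀ e f → IEF e f ≡ true → f ≡ fac (side e f) e
  inc-fac e f p with j , refl ← among-sound Fin._≟_ f (λ j → fac j e) p = cong (λ x → fac x e) (sym (side-fac e j))

  side-edgeAt : ∀ v f j → side (edgeAt v f j) f ≡ j
  side-edgeAt v f j = trans (cong (side e) (sym (fac-edgeAt v f j))) (side-fac e j)
    where e = edgeAt v f j

  edgeAt-side : ∀ v e f → IVE v e ≡ true → IEF e f ≡ true → edgeAt v f (side e f) ≡ e
  edgeAt-side v e f p p′ = trans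
    (cong₂ (λ a b → edgeAt a b (side e f)) (inc-vtx v e p) (inc-fac e f p′))
    (edgeAt-unique (proj₁ v) (side e f) e)

  Bool↔Fin2 : Bool ↔ Fin 2
  Bool↔Fin2 = ↔-sym Fin.2↔Bool

  edge-vertices : ∀ e → Σ V (λ v → IVE v e ≡ true) ↔ Fin 2
  edge-vertices e = ↔-trans (Σ↔ uip proj₁ (λ i → vtx i e) (λ i → vtx-inc i e) (λ _ → refl)
    (λ v p → sym (inc-vtx v e p))) Bool↔Fin2

  edge-faces : ∀ e → Σ F (λ f → IEF e f ≡ true) ↔ Fin 2
  edge-faces e = ↔-trans (Σ↔ uip (side e) (λ j → fac j e) (λ j → fac-inc j e) (side-fac e)
    (λ f p → sym (inc-fac e f p))) Bool↔Fin2

  diamond : ∀ v f → IVF v f ≡ true → Σ E (λ e → IVE v e ≡ true × IEF e f ≡ true) ↔ Fin 2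
  diamond v f _ = ↔-trans (Σ↔ (λ (a , b) (a′ , b′) → cong₂ _,_ (uip a a′) (uip b b′))
    (λ e → side e f) (edgeAt v f) (λ j → edgeAt-vtx v f j , edgeAt-fac v f j) (side-edgeAt v f)
    (λ e (p , p′) → edgeAt-side v e f p p′)) Bool↔Fin2

  Bool×Fin↔ : (Bool × Fin m) ↔ Fin (2 ℕ.* m)
  Bool×Fin↔ = ↔-trans (Bool↔Fin2 ×-↔ ↔-refl) (↔-sym Fin.*↔×)

  hasType : HasType polyhedron (2 ℕ.* m) q
  hasType = faces , vertices
    where
    faces : ∀ f → Σ E (λ e → IEF e f ≡ true) ↔ Fin (2 ℕ.* m)
    faces f = ↔-trans (Σ↔ uip (λ e → side e f , idx false e) (λ (j , c) → edgeAt (false , c) f j)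
      (λ (j , c) → edgeAt-fac (false , c) f j)
      (λ (j , c) → cong₂ _,_ (side-edgeAt (false , c) f j) (cong proj₂ (vtx-edgeAt (false , c) f j)))
      (λ e p → edgeAt-side (vtx false e) e f (vtx-inc false e) p)) Bool×Fin↔
    vertices : ∀ v → Σ E (λ e → IVE v e ≡ true) ↔ Fin q
    vertices v = Σ↔ uip (fac false) (λ f → edgeAt v f false)
      (λ f → edgeAt-vtx v f false) (λ f → fac-edgeAt v f false)
      (λ e p → trans (cong (λ x → edgeAt x (fac false e) false) (inc-vtx v e p)) (edgeAt-unique _ false e))

  -- Every vertex lies on every face, so a flag amounts to one of 2m vertices, one of q faces and
  -- one of the two edges common to them.
  tight : Tight polyhedron (2 ℕ.* m) q
  tight = ↔-trans (mk↔ₛ′ {B = (Bool × V) × F}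
      (λ Φ → (side (fe Φ) (ff Φ) , fv Φ) , ff Φ)
      (λ ((j , v) , f) → flag v (edgeAt v f j) f (edgeAt-vtx v f j) (edgeAt-fac v f j) refl)
      (λ ((j , v) , f) → cong (λ x → (x , v) , f) (side-edgeAt v f j))
      (λ Φ → Flag-ext polyhedron refl (edgeAt-side (fv Φ) (fe Φ) (ff Φ) (ve Φ) (ef Φ)) refl))
    (↔-trans (↔-trans (Bool↔Fin2 ×-↔ Bool×Fin↔) (↔-sym Fin.*↔×) ×-↔ ↔-refl) (↔-sym Fin.*↔×))

  connected : InducedConnected (λ _ → ⊤)
  connected = hub⇒connected polyhedron (inj₁ (false , 0S) , tt) path
    where
    path : ∀ x → Star _ x (inj₁ (false , 0S) , tt)
    path (inj₁ v , _)        = _◅_ {j = inj₂ (inj₂ 0R) , tt} refl (refl ◅ done)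
    path (inj₂ (inj₁ e) , _) = _◅_ {j = inj₂ (inj₂ (fac false e)) , tt} (fac-inc false e) (refl ◅ done)
    path (inj₂ (inj₂ f) , _) = refl ◅ done

  turn unturn : V → Fin q → Fin q
  turn (false , c) = turn₀ c
  turn (true , d)  = turn₁ d
  unturn (false , c) = unturn₀ c
  unturn (true , d)  = unturn₁ d

  turn-unturn : ∀ v f → turn v (unturn v f) ≡ f
  turn-unturn (false , c) = turn₀-unturn₀ c
  turn-unturn (true , d)  = turn₁-unturn₁ d

  turn-zero : ∀ v → turn v 0R ≡ 0R
  turn-zero (false , c) = solve 1 (λ K → con (+ 0) :* (con (+ 1) :- K) := con (+ 0)) refl (κ c)
    where open R.Solver
  turn-zero (true , d)  = solve 2 (λ K s → con (+ 0) :* (con (+ 1) :- K) :- s :* (con (+ 0) :* (con (+ 0) :- con (+ 1))) := con (+ 0)) refl (κ d) s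
    where open R.Solver

  turn-suc : ∀ v n → turn v (n + 1R) ≡ fac true (edgeAt v (turn v n) false)
  turn-suc (false , c) = turn₀-suc c
  turn-suc (true , d)  = turn₁-suc d

  vertex-links : ∀ v → InducedConnected (λ x → Inc (inj₁ v) x)
  vertex-links v = hub⇒connected polyhedron (inj₂ (inj₂ 0R) , refl) path
    where
    Link : Set
    Link = Σ Elt (Inc (inj₁ v))
    Path : Link → Set
    Path x = Star (λ (a b : Link) → Inc (proj₁ a) (proj₁ b)) x (inj₂ (inj₂ 0R) , refl)
    turns : ∀ n → Path (inj₂ (inj₂ (turn v R.[ + n ])) , refl)
    turns zero = subst (λ f → Path (inj₂ (inj₂ f) , refl)) (sym (turn-zero v)) done
    turns (suc n) = subst (λ f → Path (inj₂ (inj₂ f) , refl))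
        (sym (trans (cong (turn v) ([suc] n)) (turn-suc v _)))
        (_◅_ {j = inj₂ (inj₁ e) , edgeAt-vtx v f false} (fac-inc true e) (edgeAt-fac v f false ◅ turns n))
      where
      f = turn v R.[ + n ]
      e = edgeAt v f false
    faces : ∀ f → Path (inj₂ (inj₂ f) , refl)
    faces f = subst (λ g → Path (inj₂ (inj₂ g) , refl))
      (trans (cong (turn v) (R.⟦⟧-section (unturn v f))) (turn-unturn v f)) (turns (toℕ (unturn v f)))
    path : ∀ x → Path x
    path (inj₂ (inj₁ e) , p)    = fac-inc false e ◅ faces (fac false e)
    path (inj₂ (inj₂ f) , refl) = faces f

  S-[suc] : ∀ n → S.[ + suc n ] ≡ S.[ + n ] S.+ 1S
  S-[suc] n = trans (cong (λ x → S.[ + x ]) (ℕ.+-comm 1 n)) (S.+-homo (+ n) (+ 1))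

  -- Two steps along the boundary of f lead through the second copy and back to the first, one
  -- residue further; so the boundary passes through the whole first copy, which makes the face link
  -- connected.
  rotate-face : ∀ c f → edgeAt (vtx true (edgeAt (false , c) f true)) f false ≡ (c S.+ 1S , f)
  rotate-face c f = cong (_, f) (begin
    c S.- ρ g S.+ ρ f                   ≡⟨ cong (λ x → c S.- ρ g S.+ ρ x) (fac-edgeAt (false , c) f true) ⟨
    c S.- ρ g S.+ ρ (fac true (c , g))  ≡⟨ cong (c S.- ρ g S.+_) (ρ-fac (c , g)) ⟩
    c S.- ρ g S.+ (ρ g S.+ 1S)          ≡⟨ solve 2 (λ c x → c :- x :+ (x :+ con (+ 1)) := c :+ con (+ 1)) refl c (ρ g) ⟩
    c S.+ 1S                            ∎)
    where
    open ≡-Reasoning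
    open S.Solver
    g = f - (1R - κ c)

  face-links : ∀ f → InducedConnected (λ x → Inc (inj₂ (inj₂ f)) x)
  face-links f = hub⇒connected polyhedron (inj₁ (false , 0S) , refl) path
    where
    Link : Set
    Link = Σ Elt (Inc (inj₂ (inj₂ f)))
    Path : Link → Set
    Path x = Star (λ (a b : Link) → Inc (proj₁ a) (proj₁ b)) x (inj₁ (false , 0S) , refl)
    rotations : ∀ n → Path (inj₁ (false , S.[ + n ]) , refl)
    rotations zero = done
    rotations (suc n) = subst (λ x → Path (inj₁ (false , x) , refl))
        (trans (cong (idx false) (rotate-face c f)) (sym (S-[suc] n)))
        (_◅_ {j = inj₂ (inj₁ e′) , edgeAt-fac (vtx true e) f false} (vtx-inc false e′)
        (_◅_ {j = inj₁ (vtx true e) , refl} (edgeAt-vtx (vtx true e) f false)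
        (_◅_ {j = inj₂ (inj₁ e) , edgeAt-fac (false , c) f true} (vtx-inc true e)
        (edgeAt-vtx (false , c) f true ◅ rotations n))))
      where
      c = S.[ + n ]
      e = edgeAt (false , c) f true
      e′ = edgeAt (vtx true e) f false
    even : ∀ c → Path (inj₁ (false , c) , refl)
    even c = subst (λ x → Path (inj₁ (false , x) , refl)) (S.⟦⟧-section c) (rotations (toℕ c))
    path : ∀ x → Path x
    path (inj₁ (false , c) , refl) = even c
    path (inj₁ (true , d) , refl)  = _◅_ {j = inj₂ (inj₁ e) , edgeAt-fac (true , d) f false}
        (edgeAt-vtx (true , d) f false) (vtx-inc false e ◅ even (idx false e))
      where e = edgeAt (true , d) f false
    path (inj₂ (inj₁ e) , p)       = vtx-inc false e ◅ even (idx false e)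

  isPolyhedron : IsPolyhedron polyhedron
  isPolyhedron = record
    { edge-vertices = edge-vertices ; edge-faces = edge-faces ; diamond = diamond
    ; connected = connected ; vertex-links = vertex-links ; face-links = face-links }

  -- The two generating rotations.

  symmetry : (τ : Bool → Bool) → (∀ i → τ (τ i) ≡ i) →
    (αV : V ↔ V) (αE : E ↔ E) (αF : F ↔ F) →
    (∀ i e → vtx i (to αE e) ≡ to αV (vtx (τ i) e)) →
    (∀ j e → fac j (to αE e) ≡ to αF (fac (τ j) e)) → Aut
  symmetry τ ττ αV αE αF vtx-α fac-α = record
    { autV = αV ; autE = αE ; autF = αF
    ; pres-VE = λ v e → among-transport _≟V_ αV τ ττ (λ i → vtx i e) (λ i → vtx i (to αE e)) (λ i → vtx-α i e) v
    ; pres-EF = λ e f → among-transport Fin._≟_ αF τ ττ (λ j → fac j e) (λ j → fac j (to αE e)) (λ j → fac-α j e) f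
    ; pres-VF = λ _ _ → refl }

  -- Left multiplication on the cosets of ⟨σ₂⟩. The index d of the second copy stands for σ₁^(2d-1),
  -- so σ₁ · σ₁^(2c) = σ₁^(2c+1) has index c + 1. As σ₂σ₁ = σ₁⁻¹σ₂⁻¹ and σ₁² normalises ⟨σ₂⟩,
  -- multiplying by σ₂ turns σ₁^(2d-1) into σ₁^(2d-3), of index d - 1.
  xV xV⁻¹ yV yV⁻¹ : V → V
  xV (false , c) = true , c S.+ 1S
  xV (true  , d) = false , d
  xV⁻¹ (false , c) = true , c
  xV⁻¹ (true  , d) = false , d S.- 1S
  yV (false , c) = false , c
  yV (true  , d) = true , d S.- 1S
  yV⁻¹ (false , c) = false , c
  yV⁻¹ (true  , d) = true , d S.+ 1S

  xE xE⁻¹ yE yE⁻¹ : E → E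
  xE e   = idx true e , φ (fac true e)
  xE⁻¹ e = idx true e S.- 1S , ψ (fac true e)
  yE (c , f)   = c , f + 1R
  yE⁻¹ (c , f) = c , f - 1R

  vtx-xE : ∀ i e → vtx i (xE e) ≡ xV (vtx (not i) e)
  vtx-xE false e = refl
  vtx-xE true  e@(c , f) = cong (true ,_) (begin
    c S.- ρ f S.- ρ (φ (fac true e))     ≡⟨ cong (λ x → c S.- ρ f S.- x) (trans (ρφ _) (cong (λ x → S.- x) (ρ-fac e))) ⟩
    c S.- ρ f S.- (S.- (ρ f S.+ 1S))     ≡⟨ solve 2 (λ c x → c :- x :- (:- (x :+ con (+ 1))) := c :+ con (+ 1)) refl c (ρ f) ⟩
    c S.+ 1S                             ∎)
    where
    open ≡-Reasoning
    open S.Solver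

  fac-xE : ∀ j e → fac j (xE e) ≡ φ (fac (not j) e)
  fac-xE false e       = refl
  fac-xE true  (c , f) = φ-step c f

  vtx-xE⁻¹ : ∀ i e → vtx i (xE⁻¹ e) ≡ xV⁻¹ (vtx (not i) e)
  vtx-xE⁻¹ false e = refl
  vtx-xE⁻¹ true  e@(c , f) = cong (true ,_) (begin
    c S.- ρ f S.- 1S S.- ρ (ψ (fac true e))     ≡⟨ cong (λ x → c S.- ρ f S.- 1S S.- x) (trans (ρψ _) (cong (λ x → S.- x) (ρ-fac e))) ⟩
    c S.- ρ f S.- 1S S.- (S.- (ρ f S.+ 1S))     ≡⟨ solve 2 (λ c x → c :- x :- con (+ 1) :- (:- (x :+ con (+ 1))) := c) refl c (ρ f) ⟩
    c                                           ∎)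
    where
    open ≡-Reasoning
    open S.Solver

  fac-xE⁻¹ : ∀ j e → fac j (xE⁻¹ e) ≡ ψ (fac (not j) e)
  fac-xE⁻¹ false e       = refl
  fac-xE⁻¹ true  (c , f) = ψ-step c f

  S-add-sub : ∀ c → c S.+ 1S S.- 1S ≡ c
  S-add-sub = solve 1 (λ c → c :+ con (+ 1) :- con (+ 1) := c) refl
    where open S.Solver

  S-sub-add : ∀ c → c S.- 1S S.+ 1S ≡ c
  S-sub-add = solve 1 (λ c → c :- con (+ 1) :+ con (+ 1) := c) refl
    where open S.Solver

  R-add-sub : ∀ f → f + 1R - 1R ≡ f
  R-add-sub = solve 1 (λ c → c :+ con (+ 1) :- con (+ 1) := c) refl
    where open R.Solver

  R-sub-add : ∀ f → f - 1R + 1R ≡ f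
  R-sub-add = solve 1 (λ c → c :- con (+ 1) :+ con (+ 1) := c) refl
    where open R.Solver

  vtx-yE : ∀ i e → vtx i (yE e) ≡ yV (vtx i e)
  vtx-yE false e = refl
  vtx-yE true (c , f) = cong (true ,_) (trans (cong (λ x → c S.- x) (trans (ρ-+ f 1R) (cong (ρ f S.+_) (ρ-[] (+ 1)))))
    (solve 2 (λ c x → c :- (x :+ con (+ 1)) := c :- x :- con (+ 1)) refl c (ρ f)))
    where open S.Solver

  fac-yE : ∀ j e → fac j (yE e) ≡ fac j e + 1R
  fac-yE false e = refl
  fac-yE true (c , f) = solve 2 (λ f t → f :+ con (+ 1) :+ t := f :+ t :+ con (+ 1)) refl f (1R - κ c)
    where open R.Solver

  -- Flags in coordinates, adjacency and rigidity.

  Position : Set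
  Position = E × Bool × Bool

  toFlag : Position → Flag
  toFlag (e , i , j) = flag (vtx i e) e (fac j e) (vtx-inc i e) (fac-inc j e) refl

  position : Flag → Position
  position Φ = fe Φ , proj₁ (fv Φ) , side (fe Φ) (ff Φ)

  toFlag-position : ∀ Φ → toFlag (position Φ) ≡ Φ
  toFlag-position Φ = Flag-ext polyhedron (sym (inc-vtx (fv Φ) (fe Φ) (ve Φ))) refl (sym (inc-fac (fe Φ) (ff Φ) (ef Φ)))

  infix 4 _∶_↝_

  record _∶_↝_ (α : Aut) (p p′ : Position) : Set where
    constructor sends
    field
      flagwise : Maps-flag α (toFlag p) (toFlag p′)

  open _∶_↝_ public

  xE-xE⁻¹ : ∀ e → xE (xE⁻¹ e) ≡ e
  xE-xE⁻¹ e = cong₂ _,_ (cong proj₂ (vtx-xE⁻¹ true e)) (trans (cong φ (fac-xE⁻¹ true e)) (φψ _))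

  xE⁻¹-xE : ∀ e → xE⁻¹ (xE e) ≡ e
  xE⁻¹-xE e = cong₂ _,_ (trans (cong (λ v → proj₂ v S.- 1S) (vtx-xE true e)) (S-add-sub _))
                        (trans (cong ψ (fac-xE true e)) (ψφ _))

  yE-yE⁻¹ : ∀ e → yE (yE⁻¹ e) ≡ e
  yE-yE⁻¹ (c , f) = cong (c ,_) (R-sub-add f)

  yE⁻¹-yE : ∀ e → yE⁻¹ (yE e) ≡ e
  yE⁻¹-yE (c , f) = cong (c ,_) (R-add-sub f)

  opaque
    -- Outside this block the rotations are known only through their effect on flags, `x-sends` and
    -- `y-sends`.
    xAut yAut : Aut
    xAut = symmetry not Bool.not-involutive
      (mk↔ₛ′ xV xV⁻¹
        (λ { (false , c) → refl ; (true , d) → cong (true ,_) (S-sub-add d) })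
        (λ { (false , c) → cong (false ,_) (S-add-sub c) ; (true , d) → refl }))
      (mk↔ₛ′ xE xE⁻¹ xE-xE⁻¹ xE⁻¹-xE) (mk↔ₛ′ φ ψ φψ ψφ) vtx-xE fac-xE
    yAut = symmetry (λ i → i) (λ _ → refl)
      (mk↔ₛ′ yV yV⁻¹
        (λ { (false , c) → refl ; (true , d) → cong (true ,_) (S-add-sub d) })
        (λ { (false , c) → refl ; (true , d) → cong (true ,_) (S-sub-add d) }))
      (mk↔ₛ′ yE yE⁻¹ yE-yE⁻¹ yE⁻¹-yE) (mk↔ₛ′ (_+ 1R) (_- 1R) R-sub-add R-add-sub) vtx-yE fac-yE

    x-sends : ∀ e i j → xAut ∶ (e , i , j) ↝ (xE e , not i , not j)
    x-sends e i j = sends (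
      trans (cong (λ a → xV (vtx a e)) (sym (Bool.not-involutive i))) (sym (vtx-xE (not i) e)) , refl ,
      trans (cong (λ a → φ (fac a e)) (sym (Bool.not-involutive j))) (sym (fac-xE (not j) e)))

    y-sends : ∀ e i j → yAut ∶ (e , i , j) ↝ (yE e , i , j)
    y-sends e i j = sends (sym (vtx-yE i e) , refl , sym (fac-yE j e))

  base : Position
  base = (0S , 0R) , false , false

  -- rᵢ p is the flag Φⁱ, where Φ is the flag at p.
  r₀ r₁ r₂ : Position → Position
  r₀ (e , i , j) = e , not i , j
  r₁ (e , i , j) = edgeAt (vtx i e) (fac j e) (not j) , i , not j
  r₂ (e , i , j) = e , i , not j

  edgeAt-not≢ : ∀ i j e → edgeAt (vtx i e) (fac j e) (not j) ≢ e
  edgeAt-not≢ i j e eq = not≢ (fac-injective (not j) j e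
    (trans (cong (fac (not j)) (sym eq)) (fac-edgeAt (vtx i e) (fac j e) (not j))))

  module _ {α : Aut} where
    open Aut α

    -- The element that changes must land on one of two candidates, and injectivity excludes the one
    -- already taken by the image of the original element. The same argument serves `↝-r₂` and
    -- `↝-r₁`.
    ↝-r₀ : ∀ p p′ → α ∶ p ↝ p′ → α ∶ r₀ p ↝ r₀ p′
    ↝-r₀ (e , i , j) (e′ , i′ , j′) (sends (pv , pe , pf)) = sends (other , pe , pf)
      where
      a = proj₁ (to autV (vtx (not i) e))
      at : to autV (vtx (not i) e) ≡ vtx a e′
      at = inc-vtx _ e′ (subst (λ x → IVE (to autV (vtx (not i) e)) x ≡ true) pe (trans (pres-VE (vtx (not i) e) e) (vtx-inc (not i) e)))
      other : to autV (vtx (not i) e) ≡ vtx (not i′) e′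
      other with same-or-not a i′
      ... | inj₁ eq = contradiction
            (cong proj₁ (to-injective autV (trans at (trans (cong (λ x → vtx x e′) eq) (sym pv))))) not≢
      ... | inj₂ eq = trans at (cong (λ x → vtx x e′) eq)

    ↝-r₂ : ∀ p p′ → α ∶ p ↝ p′ → α ∶ r₂ p ↝ r₂ p′
    ↝-r₂ (e , i , j) (e′ , i′ , j′) (sends (pv , pe , pf)) = sends (pv , pe , other)
      where
      a = side e′ (to autF (fac (not j) e))
      at : to autF (fac (not j) e) ≡ fac a e′
      at = inc-fac e′ _ (subst (λ x → IEF x (to autF (fac (not j) e)) ≡ true) pe (trans (pres-EF e (fac (not j) e)) (fac-inc (not j) e)))
      other : to autF (fac (not j) e) ≡ fac (not j′) e′
      other with same-or-not a j′
      ... | inj₁ eq = contradiction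
            (fac-injective (not j) j e (to-injective autF (trans at (trans (cong (λ x → fac x e′) eq) (sym pf))))) not≢
      ... | inj₂ eq = trans at (cong (λ x → fac x e′) eq)

    ↝-r₁ : ∀ p p′ → α ∶ p ↝ p′ → α ∶ r₁ p ↝ r₁ p′
    ↝-r₁ (e , i , j) (e′ , i′ , j′) (sends (pv , pe , pf)) = sends (
        trans (cong (to autV) (vtx-edgeAt v f (not j))) (trans pv (sym (vtx-edgeAt v′ f′ (not j′)))) , other ,
        trans (cong (to autF) (fac-edgeAt v f (not j))) (trans pf (sym (fac-edgeAt v′ f′ (not j′)))))
      where
      v = vtx i e
      f = fac j e
      v′ = vtx i′ e′
      f′ = fac j′ e′
      e₁ = edgeAt v f (not j)
      a = side (to autE e₁) f′
      at : to autE e₁ ≡ edgeAt v′ f′ a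
      at = sym (edgeAt-side v′ (to autE e₁) f′
        (subst (λ x → IVE x (to autE e₁) ≡ true) pv (trans (pres-VE v e₁) (edgeAt-vtx v f (not j))))
        (subst (λ x → IEF (to autE e₁) x ≡ true) pf (trans (pres-EF e₁ f) (edgeAt-fac v f (not j)))))
      other : to autE e₁ ≡ edgeAt v′ f′ (not j′)
      other with same-or-not a j′
      ... | inj₁ eq = contradiction
            (to-injective autE (trans at (trans (cong (edgeAt v′ f′) eq) (trans (edgeAt-unique i′ j′ e′) (sym pe)))))
            (edgeAt-not≢ i j e)
      ... | inj₂ eq = trans at (cong (edgeAt v′ f′) eq)

  ↝-∘ : ∀ α β {p} p′ {p″} → α ∶ p′ ↝ p″ → β ∶ p ↝ p′ → _∘Aut_ polyhedron α β ∶ p ↝ p″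
  ↝-∘ α β p′ (sends (av , ae , af)) (sends (bv , be , bf)) = sends (
    trans (cong (to (Aut.autV α)) bv) av , trans (cong (to (Aut.autE α)) be) ae , trans (cong (to (Aut.autF α)) bf) af)

  ↝-inv : ∀ α p p′ → α ∶ p ↝ p′ → invAut polyhedron α ∶ p′ ↝ p
  ↝-inv α p p′ (sends (pv , pe , pf)) = sends (back (Aut.autV α) pv , back (Aut.autE α) pe , back (Aut.autF α) pf)
    where
    back : {X : Set} (i : X ↔ X) → ∀ {x y} → to i x ≡ y → from i y ≡ x
    back i refl = Inverse.strictlyInverseʳ i _

  -- The moves Φ ↦ (Φ¹)⁰ and Φ ↦ (Φ²)¹ made at an arbitrary flag. They commute with automorphisms,
  -- so starting from the base flag they spell out words in σ₁, σ₂ read from right to left.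
  stepA stepB : Position → Position
  stepA p = r₀ (r₁ p)
  stepB p = r₁ (r₂ p)

  iterate : {X : Set} → (X → X) → ℕ → X → X
  iterate g zero    x = x
  iterate g (suc n) x = g (iterate g n x)

  stepAA-white : ∀ c f → stepA (stepA ((c , f) , false , false)) ≡ ((c S.+ 1S , f) , false , false)
  stepAA-white c f = cong (_, false , false) (trans
    (cong (λ g → edgeAt (vtx true (edgeAt (false , c) f true)) g false) (fac-edgeAt (false , c) f true))
    (rotate-face c f))

  stepB-white : ∀ n c f → iterate stepB n ((c , f) , false , false) ≡ ((c , f + R.[ + n ] * (1R - κ c)) , false , false)
  stepB-white zero    c f = cong (λ x → (c , x) , false , false)
    (solve 2 (λ f t → f := f :+ con (+ 0) :* t) refl f (1R - κ c))
    where open R.Solver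
  stepB-white (suc n) c f = trans (cong stepB (stepB-white n c f)) (cong (λ x → (c , x) , false , false)
    (trans (solve 3 (λ f n t → f :+ n :* t :+ t := f :+ (n :+ con (+ 1)) :* t) refl f R.[ + n ] (1R - κ c))
           (cong (λ x → f + x * (1R - κ c)) (sym ([suc] n)))))
    where open R.Solver

  -- Flag connectedness: `stepA` twice moves along face 0 through the first copy, `stepB` then
  -- rotates about the vertex reached to any face, and `r₀`, `r₂` supply the other three flags on
  -- the same edge.
  flag-induction : (Q : Position → Set) → (∀ p → Q p → Q (r₀ p)) → (∀ p → Q p → Q (r₁ p)) →
    (∀ p → Q p → Q (r₂ p)) → Q base → ∀ p → Q p
  flag-induction Q Q₀ Q₁ Q₂ Qbase = all
    where
    Q-stepA : ∀ p → Q p → Q (stepA p)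
    Q-stepA p q = Q₀ (r₁ p) (Q₁ p q)
    along : ∀ n → Q ((S.[ + n ] , 0R) , false , false)
    along zero    = Qbase
    along (suc n) = subst Q (trans (stepAA-white _ 0R) (cong (λ c → (c , 0R) , false , false) (sym (S-[suc] n))))
      (Q-stepA _ (Q-stepA ((S.[ + n ] , 0R) , false , false) (along n)))
    Q-iterate : ∀ n p → Q p → Q (iterate stepB n p)
    Q-iterate zero    p q = q
    Q-iterate (suc n) p q = Q₁ _ (Q₂ (iterate stepB n p) (Q-iterate n p q))
    white : ∀ e → Q (e , false , false)
    white (c , f) = subst Q eq (Q-iterate (toℕ n) _ (subst (λ x → Q ((x , 0R) , false , false)) (S.⟦⟧-section c) (along (toℕ c))))
      where
      n = unturn₀ c f
      open R.Solver
      eq : iterate stepB (toℕ n) ((c , 0R) , false , false) ≡ ((c , f) , false , false)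
      eq = trans (stepB-white (toℕ n) c 0R) (cong (λ x → (c , x) , false , false)
        (trans (cong (λ x → 0R + x * (1R - κ c)) (R.⟦⟧-section n))
        (trans (solve 1 (λ x → con (+ 0) :+ x := x) refl (n * (1R - κ c))) (turn₀-unturn₀ c f))))
    all : ∀ p → Q p
    all (e , false , false) = white e
    all (e , false , true)  = Q₂ (e , false , false) (white e)
    all (e , true , false)  = Q₀ (e , false , false) (white e)
    all (e , true , true)   = Q₀ (e , false , true) (Q₂ (e , false , false) (white e))

  rigidity : ∀ α β {p} → α ∶ base ↝ p → β ∶ base ↝ p → toMaps α ≐ toMaps β
  rigidity α β {p} a b = onV , onE , onF
    where
    Agree : Position → Set
    Agree p = ∃ λ p′ → α ∶ p ↝ p′ × β ∶ p ↝ p′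
    agree : ∀ p → Agree p
    agree = flag-induction Agree
      (λ p (p′ , a , b) → r₀ p′ , ↝-r₀ p p′ a , ↝-r₀ p p′ b) (λ p (p′ , a , b) → r₁ p′ , ↝-r₁ p p′ a , ↝-r₁ p p′ b)
      (λ p (p′ , a , b) → r₂ p′ , ↝-r₂ p p′ a , ↝-r₂ p p′ b) (p , a , b)
    module _ (p : Position) where
      private
        a′ = flagwise (proj₁ (proj₂ (agree p)))
        b′ = flagwise (proj₂ (proj₂ (agree p)))
      sameV : to (Aut.autV α) (fv (toFlag p)) ≡ to (Aut.autV β) (fv (toFlag p))
      sameV = trans (proj₁ a′) (sym (proj₁ b′))
      sameE : to (Aut.autE α) (fe (toFlag p)) ≡ to (Aut.autE β) (fe (toFlag p))
      sameE = trans (proj₁ (proj₂ a′)) (sym (proj₁ (proj₂ b′)))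
      sameF : to (Aut.autF α) (ff (toFlag p)) ≡ to (Aut.autF β) (ff (toFlag p))
      sameF = trans (proj₂ (proj₂ a′)) (sym (proj₂ (proj₂ b′)))
    onE : ∀ e → to (Aut.autE α) e ≡ to (Aut.autE β) e
    onE e = sameE (e , false , false)
    onF : ∀ f → to (Aut.autF α) f ≡ to (Aut.autF β) f
    onF f = sameF ((0S , f) , false , false)
    onV : ∀ v → to (Aut.autV α) v ≡ to (Aut.autV β) v
    onV v = subst (λ x → to (Aut.autV α) x ≡ to (Aut.autV β) x) (vtx-edgeAt v 0R false)
      (sameV (edgeAt v 0R false , proj₁ v , false))

-- Normal forms in the presented group.

module Presentation (m q n₀ : ℕ) (i₁ j₁ : ℤ) .{{m≢0 : ℕ.NonZero m}} .{{q≢0 : ℕ.NonZero q}} where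

  infix 4 _≈_

  _≈_ : Word → Word → Set
  _≈_ = Γ≈ (2 ℕ.* m) q i₁ j₁ -[1+ 2 ] (+ n₀)

  Γ : Group 0ℓ 0ℓ
  Γ = record
    { Carrier = Word ; _≈_ = _≈_ ; _∙_ = _·_ ; ε = ε ; _⁻¹ = _⁻¹
    ; isGroup = record
      { isMonoid = record
        { isSemigroup = record
          { isMagma = record
            { isEquivalence = record { refl = ≈-refl ; sym = ≈-sym ; trans = ≈-trans }
            ; ∙-cong = ·-cong }
          ; assoc = assoc }
        ; identity = idˡ , idʳ }
      ; inverse = invˡ , invʳ
      ; ⁻¹-cong = ⁻¹-cong } }

  open GroupProperties Γ using (inverseˡ-unique; ⁻¹-anti-homo-∙)
  open SetoidReasoning (Group.setoid Γ)

  ·-congˡ : ∀ u {v w} → v ≈ w → u · v ≈ u · w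
  ·-congˡ u = ·-cong (≈-refl {w = u})

  ·-congʳ : ∀ w {u v} → u ≈ v → u · w ≈ v · w
  ·-congʳ w eq = ·-cong eq (≈-refl {w = w})

  pow-+ : ∀ w a b → pow w (a ℕ.+ b) ≈ pow w a · pow w b
  pow-+ w zero    b = ≈-sym (idˡ _)
  pow-+ w (suc a) b = ≈-trans (·-congˡ w (pow-+ w a b)) (≈-sym (assoc _ _ _))

  pow-comm : ∀ w n → pow w n · w ≈ w · pow w n
  pow-comm w zero    = ≈-trans (idˡ w) (≈-sym (idʳ w))
  pow-comm w (suc n) = ≈-trans (assoc _ _ _) (·-congˡ w (pow-comm w n))

  pow-multiple : ∀ {w n} d → pow w n ≈ ε → pow w (d ℕ.* n) ≈ ε
  pow-multiple zero    eq = ≈-refl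
  pow-multiple {w} {n} (suc d) eq =
    ≈-trans (pow-+ w n (d ℕ.* n)) (≈-trans (·-cong eq (pow-multiple d eq)) (idˡ ε))

  σ₁² : Word
  σ₁² = σ₁ · σ₁

  σ₁²-assoc : ∀ w → σ₁² · w ≈ σ₁ · (σ₁ · w)
  σ₁²-assoc w = assoc σ₁ σ₁ w

  pow-σ₁-even : ∀ n → pow σ₁ (2 ℕ.* n) ≈ pow σ₁² n
  pow-σ₁-even zero    = ≈-refl
  pow-σ₁-even (suc n) = begin
    pow σ₁ (2 ℕ.* suc n)          ≡⟨ cong (pow σ₁) (ℕ.*-suc 2 n) ⟩
    σ₁ · (σ₁ · pow σ₁ (2 ℕ.* n))  ≈⟨ assoc _ _ _ ⟨
    σ₁² · pow σ₁ (2 ℕ.* n)        ≈⟨ ·-congˡ σ₁² (pow-σ₁-even n) ⟩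
    σ₁² · pow σ₁² n               ∎

  -- The exponent 2m - 1 is split as 2(m - 1) + 1 because powers of σ₁² can be moved past σ₂,
  -- leaving a single σ₁ to deal with.
  σ₁⁻¹≈ : σ₁ ⁻¹ ≈ pow σ₁² (ℕ.pred m) · σ₁
  σ₁⁻¹≈ = ≈-sym (inverseˡ-unique _ _ (begin
    pow σ₁² (ℕ.pred m) · σ₁ · σ₁    ≈⟨ assoc _ _ _ ⟩
    pow σ₁² (ℕ.pred m) · σ₁²        ≈⟨ pow-comm σ₁² (ℕ.pred m) ⟩
    pow σ₁² (suc (ℕ.pred m))        ≡⟨ cong (pow σ₁²) (ℕ.suc-pred m) ⟩
    pow σ₁² m                       ≈⟨ pow-σ₁-even m ⟨
    pow σ₁ (2 ℕ.* m)                ≈⟨ rel₁ ⟩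
    ε                               ∎))

  σ₂⁻¹≈ : σ₂ ⁻¹ ≈ pow σ₂ (ℕ.pred q)
  σ₂⁻¹≈ = ≈-sym (inverseˡ-unique _ _ (begin
    pow σ₂ (ℕ.pred q) · σ₂        ≈⟨ pow-comm σ₂ (ℕ.pred q) ⟩
    pow σ₂ (suc (ℕ.pred q))       ≡⟨ cong (pow σ₂) (ℕ.suc-pred q) ⟩
    pow σ₂ q                      ≈⟨ rel₂ ⟩
    ε                             ∎))

  -- The relations give a commutation rule for σ₁² with σ₂⁻¹; this converts it into one for σ₂.
  σ₂≈ : σ₂ ≈ pow (σ₂ ⁻¹) (ℕ.pred q)
  σ₂≈ = ≈-trans (inverseˡ-unique _ _ (invʳ σ₂)) (≈-sym (inverseˡ-unique _ _ (begin
    pow (σ₂ ⁻¹) (ℕ.pred q) · σ₂ ⁻¹    ≈⟨ pow-comm (σ₂ ⁻¹) (ℕ.pred q) ⟩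
    pow (σ₂ ⁻¹) (suc (ℕ.pred q))      ≡⟨ cong (pow (σ₂ ⁻¹)) (ℕ.suc-pred q) ⟩
    pow (σ₂ ⁻¹) q                     ≈⟨ pow-inverse q ⟩
    pow σ₂ q ⁻¹                       ≈⟨ ⁻¹-cong rel₂ ⟩
    ε ⁻¹                              ≈⟨ inverseˡ-unique _ _ (idˡ ε) ⟨
    ε                                 ∎)))
    where
    pow-inverse : ∀ n → pow (σ₂ ⁻¹) n ≈ pow σ₂ n ⁻¹
    pow-inverse zero    = inverseˡ-unique _ _ (idˡ ε)
    pow-inverse (suc n) = begin
      σ₂ ⁻¹ · pow (σ₂ ⁻¹) n    ≈⟨ pow-comm (σ₂ ⁻¹) n ⟨
      pow (σ₂ ⁻¹) n · σ₂ ⁻¹    ≈⟨ ·-congʳ (σ₂ ⁻¹) (pow-inverse n) ⟩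
      pow σ₂ n ⁻¹ · σ₂ ⁻¹      ≈⟨ ⁻¹-anti-homo-∙ σ₂ (pow σ₂ n) ⟨
      (σ₂ · pow σ₂ n) ⁻¹       ∎

  involution : (σ₁ · σ₂) · (σ₁ · σ₂) ≈ ε
  involution = ≈-trans (·-congˡ _ (≈-sym (idʳ _))) rel₃

  σ₁σ₂≈ : σ₁ · σ₂ ≈ σ₂ ⁻¹ · σ₁ ⁻¹
  σ₁σ₂≈ = ≈-trans (inverseˡ-unique _ _ involution) (⁻¹-anti-homo-∙ σ₁ σ₂)

  σ₁σ₂σ₁≈ : σ₁ · (σ₂ · σ₁) ≈ σ₂ ⁻¹
  σ₁σ₂σ₁≈ = inverseˡ-unique _ _ (begin
    σ₁ · (σ₂ · σ₁) · σ₂         ≈⟨ ·-congʳ σ₂ (assoc _ _ _) ⟨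
    σ₁ · σ₂ · σ₁ · σ₂           ≈⟨ assoc _ _ _ ⟩
    σ₁ · σ₂ · (σ₁ · σ₂)         ≈⟨ involution ⟩
    ε                           ∎)

  cancelˡ : ∀ u w → u · (u ⁻¹ · w) ≈ w
  cancelˡ u w = ≈-trans (≈-sym (assoc _ _ _)) (≈-trans (·-congʳ w (invʳ u)) (idˡ w))

  pow-σ₂-σ₁ : pow σ₂ n₀ · σ₁ ≈ σ₁² · (σ₁ · σ₂)
  pow-σ₂-σ₁ = begin
    pow σ₂ n₀ · σ₁                                 ≈⟨ ·-congʳ σ₁ cube ⟨
    σ₁ · (σ₁ · (σ₁ · (σ₂ · σ₁ ⁻¹))) · σ₁           ≈⟨ ·-congʳ σ₁ (≈-trans (≈-sym (σ₁²-assoc _)) (≈-trans (·-congˡ σ₁² (≈-sym (assoc _ _ _))) (≈-sym (assoc _ _ _)))) ⟩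
    σ₁² · (σ₁ · σ₂) · σ₁ ⁻¹ · σ₁                   ≈⟨ assoc _ _ _ ⟩
    σ₁² · (σ₁ · σ₂) · (σ₁ ⁻¹ · σ₁)                 ≈⟨ ·-congˡ _ (invˡ σ₁) ⟩
    σ₁² · (σ₁ · σ₂) · ε                            ≈⟨ idʳ _ ⟩
    σ₁² · (σ₁ · σ₂)                                ∎
    where
    cube : σ₁ · (σ₁ · (σ₁ · (σ₂ · σ₁ ⁻¹))) ≈ pow σ₂ n₀
    cube = begin
      σ₁ · (σ₁ · (σ₁ · (σ₂ · σ₁ ⁻¹)))
        ≈⟨ ·-congˡ σ₁ (·-congˡ σ₁ (·-congˡ σ₁ rel₅)) ⟩
      σ₁ · (σ₁ · (σ₁ · (σ₁ ⁻¹ · (σ₁ ⁻¹ · (σ₁ ⁻¹ · ε)) · pow σ₂ n₀)))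
        ≈⟨ ·-congˡ σ₁ (·-congˡ σ₁ (·-congˡ σ₁ (≈-trans (assoc _ _ _) (·-congˡ (σ₁ ⁻¹) (≈-trans (assoc _ _ _) (·-congˡ (σ₁ ⁻¹) (·-congʳ (pow σ₂ n₀) (idʳ (σ₁ ⁻¹))))))))) ⟩
      σ₁ · (σ₁ · (σ₁ · (σ₁ ⁻¹ · (σ₁ ⁻¹ · (σ₁ ⁻¹ · pow σ₂ n₀)))))
        ≈⟨ ·-congˡ σ₁ (·-congˡ σ₁ (cancelˡ σ₁ _)) ⟩
      σ₁ · (σ₁ · (σ₁ ⁻¹ · (σ₁ ⁻¹ · pow σ₂ n₀)))
        ≈⟨ ·-congˡ σ₁ (cancelˡ σ₁ _) ⟩
      σ₁ · (σ₁ ⁻¹ · pow σ₂ n₀)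
        ≈⟨ cancelˡ σ₁ _ ⟩
      pow σ₂ n₀ ∎

  -- σ₁² normalises ⟨σ₂⟩: by rel₅, σ₂^n₀ σ₁ = σ₁³ σ₂, and σ₁ σ₂ σ₁ = σ₂⁻¹.
  σ₁²-σ₂⁻¹ : σ₁² · σ₂ ⁻¹ ≈ pow σ₂ n₀ · σ₁²
  σ₁²-σ₂⁻¹ = begin
    σ₁² · σ₂ ⁻¹                    ≈⟨ ·-congˡ σ₁² σ₁σ₂σ₁≈ ⟨
    σ₁² · (σ₁ · (σ₂ · σ₁))         ≈⟨ ·-congˡ σ₁² (assoc _ _ _) ⟨
    σ₁² · (σ₁ · σ₂ · σ₁)           ≈⟨ assoc _ _ _ ⟨
    σ₁² · (σ₁ · σ₂) · σ₁           ≈⟨ ·-congʳ σ₁ pow-σ₂-σ₁ ⟨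
    pow σ₂ n₀ · σ₁ · σ₁            ≈⟨ assoc _ _ _ ⟩
    pow σ₂ n₀ · σ₁²                ∎

  move-past : ∀ {a b g} → a · b ≈ pow σ₂ g · a → ∀ n → a · pow b n ≈ pow σ₂ (n ℕ.* g) · a
  move-past {a} {b} {g} eq zero    = ≈-trans (idʳ a) (≈-sym (idˡ a))
  move-past {a} {b} {g} eq (suc n) = begin
    a · (b · pow b n)                              ≈⟨ assoc _ _ _ ⟨
    a · b · pow b n                                ≈⟨ ·-congʳ (pow b n) eq ⟩
    pow σ₂ g · a · pow b n                         ≈⟨ assoc _ _ _ ⟩
    pow σ₂ g · (a · pow b n)                       ≈⟨ ·-congˡ _ (move-past eq n) ⟩
    pow σ₂ g · (pow σ₂ (n ℕ.* g) · a)              ≈⟨ assoc _ _ _ ⟨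
    pow σ₂ g · pow σ₂ (n ℕ.* g) · a                ≈⟨ ·-congʳ a (pow-+ σ₂ g (n ℕ.* g)) ⟨
    pow σ₂ (suc n ℕ.* g) · a                       ∎

  -- A natural number congruent to 1 - N modulo q when `n₀` is N - 1: the power to which conjugation
  -- by σ₁² raises σ₂.
  g₀ : ℕ
  g₀ = ℕ.pred q ℕ.* n₀

  σ₁²-pow-σ₂ : ∀ n → σ₁² · pow σ₂ n ≈ pow σ₂ (n ℕ.* g₀) · σ₁²
  σ₁²-pow-σ₂ = move-past (≈-trans (·-congˡ σ₁² σ₂≈) (move-past σ₁²-σ₂⁻¹ (ℕ.pred q)))

  -- The exponents are arbitrary naturals; reduction modulo q and 2m is postponed to `even-trivial`,
  -- where `rel₁` and `rel₂` are applied.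
  NormalForm : Word → Set
  NormalForm w = ∃ λ f → ∃ λ a → w ≈ pow σ₂ f · pow σ₁ a

  nf-resp : ∀ {u w} → u ≈ w → NormalForm w → NormalForm u
  nf-resp eq (f , a , eq′) = f , a , ≈-trans eq eq′

  Closed : Word → Set
  Closed u = ∀ {w} → NormalForm w → NormalForm (u · w)

  closed-pow : ∀ {u} n → Closed u → Closed (pow u n)
  closed-pow zero    cl nf = nf-resp (idˡ _) nf
  closed-pow (suc n) cl nf = nf-resp (assoc _ _ _) (cl (closed-pow n cl nf))

  closed-σ₂ : Closed σ₂
  closed-σ₂ (f , a , eq) = suc f , a , ≈-trans (·-congˡ σ₂ eq) (≈-sym (assoc _ _ _))

  closed-σ₁² : Closed σ₁²
  closed-σ₁² {w} (f , a , eq) = f ℕ.* g₀ , suc (suc a) , (begin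
    σ₁² · w                                        ≈⟨ ·-congˡ σ₁² eq ⟩
    σ₁² · (pow σ₂ f · pow σ₁ a)                    ≈⟨ assoc _ _ _ ⟨
    σ₁² · pow σ₂ f · pow σ₁ a                      ≈⟨ ·-congʳ (pow σ₁ a) (σ₁²-pow-σ₂ f) ⟩
    pow σ₂ (f ℕ.* g₀) · σ₁² · pow σ₁ a             ≈⟨ assoc _ _ _ ⟩
    pow σ₂ (f ℕ.* g₀) · (σ₁² · pow σ₁ a)           ≈⟨ ·-congˡ _ (σ₁²-assoc _) ⟩
    pow σ₂ (f ℕ.* g₀) · (σ₁ · (σ₁ · pow σ₁ a))     ∎)

  -- Descent on f: σ₁σ₂ = σ₂⁻¹σ₁⁻¹ consumes one σ₂, and the expansion of σ₁⁻¹ again leaves a single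
  -- σ₁ in front of the shorter power. The factors to its left are powers of σ₂ and σ₁², which
  -- preserve normal forms.
  nf-σ₁-pow-σ₂ : ∀ f → NormalForm (σ₁ · pow σ₂ f)
  nf-σ₁-pow-σ₂ zero    = 0 , 1 , ≈-sym (idˡ _)
  nf-σ₁-pow-σ₂ (suc f) = nf-resp (begin
    σ₁ · (σ₂ · pow σ₂ f)                                           ≈⟨ assoc _ _ _ ⟨
    σ₁ · σ₂ · pow σ₂ f                                             ≈⟨ ·-congʳ _ σ₁σ₂≈ ⟩
    σ₂ ⁻¹ · σ₁ ⁻¹ · pow σ₂ f                                       ≈⟨ ·-congʳ _ (·-cong σ₂⁻¹≈ σ₁⁻¹≈) ⟩
    pow σ₂ (ℕ.pred q) · (pow σ₁² (ℕ.pred m) · σ₁) · pow σ₂ f       ≈⟨ assoc _ _ _ ⟩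
    pow σ₂ (ℕ.pred q) · (pow σ₁² (ℕ.pred m) · σ₁ · pow σ₂ f)       ≈⟨ ·-congˡ _ (assoc _ _ _) ⟩
    pow σ₂ (ℕ.pred q) · (pow σ₁² (ℕ.pred m) · (σ₁ · pow σ₂ f))     ∎)
    (closed-pow (ℕ.pred q) closed-σ₂ (closed-pow (ℕ.pred m) closed-σ₁² (nf-σ₁-pow-σ₂ f)))

  closed-σ₁ : Closed σ₁
  closed-σ₁ {w} (f , a , eq) with g , b , eq′ ← nf-σ₁-pow-σ₂ f = g , b ℕ.+ a , (begin
    σ₁ · w                                ≈⟨ ·-congˡ σ₁ eq ⟩
    σ₁ · (pow σ₂ f · pow σ₁ a)            ≈⟨ assoc _ _ _ ⟨
    σ₁ · pow σ₂ f · pow σ₁ a              ≈⟨ ·-congʳ (pow σ₁ a) eq′ ⟩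
    pow σ₂ g · pow σ₁ b · pow σ₁ a        ≈⟨ assoc _ _ _ ⟩
    pow σ₂ g · (pow σ₁ b · pow σ₁ a)      ≈⟨ ·-congˡ _ (pow-+ σ₁ b a) ⟨
    pow σ₂ g · pow σ₁ (b ℕ.+ a)           ∎)

  closed : ∀ u → Closed u × Closed (u ⁻¹)
  closed σ₁ = closed-σ₁ , λ nf → nf-resp (≈-trans (·-congʳ _ σ₁⁻¹≈) (assoc _ _ _))
    (closed-pow (ℕ.pred m) closed-σ₁² (closed-σ₁ nf))
  closed σ₂ = closed-σ₂ , λ nf → nf-resp (·-congʳ _ σ₂⁻¹≈) (closed-pow (ℕ.pred q) closed-σ₂ nf)
  closed ε = nf-resp (idˡ _) , nf-resp (≈-trans (·-congʳ _ (≈-sym (inverseˡ-unique _ _ (idˡ ε)))) (idˡ _))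
  closed (u · w) =
    (λ nf → nf-resp (assoc _ _ _) (proj₁ (closed u) (proj₁ (closed w) nf))) ,
    (λ nf → nf-resp (≈-trans (·-congʳ _ (⁻¹-anti-homo-∙ u w)) (assoc _ _ _)) (proj₂ (closed w) (proj₂ (closed u) nf)))
  closed (w ⁻¹) = proj₂ (closed w) ,
    (λ nf → nf-resp (·-congʳ _ (≈-sym (inverseˡ-unique _ _ (invʳ w)))) (proj₁ (closed w) nf))

  normalForm : ∀ w → NormalForm w
  normalForm w = nf-resp (≈-sym (idʳ w)) (proj₁ (closed w) (0 , 0 , ≈-sym (idˡ ε)))

-- Words acting on the polyhedron.

module Realisation (m L k h : ℕ) .{{m≢0 : ℕ.NonZero m}} .{{q≢0 : ℕ.NonZero (m ℕ.* (m ℕ.* L))}}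
                   (2h≡1+m : h ℕ.+ h ≡ suc m) (1<m : 1 ℕ.< m)
                   (q∤2N : ¬ (m ℕ.* (m ℕ.* L) ℕ.∣ k ℕ.* (m ℕ.* L) ℕ.+ k ℕ.* (m ℕ.* L)))
                   (n₀ : ℕ) (N≡1+n₀ : k ℕ.* (m ℕ.* L) ≡ suc n₀) where

  open Polyhedron m L k h 2h≡1+m 1<m public
  open R using (_+_; _*_; -_; _-_)
  open RankedPoset polyhedron hiding (V; E; F)

  ⟪_⟫ : Word → Aut
  ⟪ w ⟫ = evalAut polyhedron xAut yAut w

  -- The action written on coordinates, so that comparing images of the base flag becomes arithmetic
  -- in ℤ/m and ℤ/q.
  act act⁻¹ : Word → Position → Position
  act σ₁ (e , i , j) = xE e , not i , not j
  act σ₂ (e , i , j) = yE e , i , j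
  act ε p            = p
  act (u · w) p      = act u (act w p)
  act (w ⁻¹) p       = act⁻¹ w p
  act⁻¹ σ₁ (e , i , j) = xE⁻¹ e , not i , not j
  act⁻¹ σ₂ (e , i , j) = yE⁻¹ e , i , j
  act⁻¹ ε p            = p
  act⁻¹ (u · w) p      = act⁻¹ w (act⁻¹ u p)
  act⁻¹ (w ⁻¹) p       = act w p

  x⁻¹-sends : ∀ e i j → invAut polyhedron xAut ∶ (e , i , j) ↝ (xE⁻¹ e , not i , not j)
  x⁻¹-sends e i j = ↝-inv xAut (xE⁻¹ e , not i , not j) (e , i , j)
    (subst (xAut ∶ (xE⁻¹ e , not i , not j) ↝_)
      (cong₂ _,_ (xE-xE⁻¹ e) (cong₂ _,_ (Bool.not-involutive i) (Bool.not-involutive j)))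
      (x-sends (xE⁻¹ e) (not i) (not j)))

  y⁻¹-sends : ∀ e i j → invAut polyhedron yAut ∶ (e , i , j) ↝ (yE⁻¹ e , i , j)
  y⁻¹-sends e i j = ↝-inv yAut (yE⁻¹ e , i , j) (e , i , j)
    (subst (yAut ∶ (yE⁻¹ e , i , j) ↝_) (cong (_, i , j) (yE-yE⁻¹ e)) (y-sends (yE⁻¹ e) i j))

  word-sends : ∀ w p → ⟪ w ⟫ ∶ p ↝ act w p
  inverse-sends : ∀ w p → invAut polyhedron ⟪ w ⟫ ∶ p ↝ act⁻¹ w p

  word-sends σ₁ (e , i , j) = x-sends e i j
  word-sends σ₂ (e , i , j) = y-sends e i j
  word-sends ε p       = sends (refl , refl , refl)
  word-sends (u · w) p = ↝-∘ ⟪ u ⟫ ⟪ w ⟫ (act w p) (word-sends u (act w p)) (word-sends w p)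
  word-sends (w ⁻¹) p  = inverse-sends w p

  inverse-sends σ₁ (e , i , j) = x⁻¹-sends e i j
  inverse-sends σ₂ (e , i , j) = y⁻¹-sends e i j
  inverse-sends ε p       = sends (refl , refl , refl)
  -- The inverse of a composite and the composite of inverses have the same underlying maps but
  -- different preservation proofs; rewrapping passes from one automorphism to the other.
  inverse-sends (u · w) p = sends (flagwise (↝-∘ (invAut polyhedron ⟪ w ⟫) (invAut polyhedron ⟪ u ⟫) (act⁻¹ u p) (inverse-sends w (act⁻¹ u p)) (inverse-sends u p)))
  inverse-sends (w ⁻¹) p  = sends (flagwise (word-sends w p))

  act-pow-σ₂ : ∀ n c f i j → act (pow σ₂ n) ((c , f) , i , j) ≡ ((c , f + R.[ + n ]) , i , j)
  act-pow-σ₂ zero c f i j = cong (λ x → (c , x) , i , j) (solve 1 (λ f → f := f :+ con (+ 0)) refl f)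
    where open R.Solver
  act-pow-σ₂ (suc n) c f i j = trans (cong (act σ₂) (act-pow-σ₂ n c f i j)) (cong (λ x → (c , x) , i , j)
    (trans (solve 2 (λ f n → f :+ n :+ con (+ 1) := f :+ (n :+ con (+ 1))) refl f R.[ + n ])
           (cong (_+_ f) (sym ([suc] n)))))
    where open R.Solver

  xE-xE : ∀ c f → xE (xE (c , f)) ≡ (c S.+ 1S , f - r * f)
  xE-xE c f = cong₂ _,_ (cong proj₂ (vtx-xE true (c , f))) (trans (cong φ (fac-xE true (c , f))) (φφ f))

  xE⁻¹-xE⁻¹ : ∀ c f → xE⁻¹ (xE⁻¹ (c , f)) ≡ (c S.- 1S , f + r * f)
  xE⁻¹-xE⁻¹ c f = cong₂ _,_ (cong (λ v → proj₂ v S.- 1S) (vtx-xE⁻¹ true (c , f)))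
    (trans (cong ψ (fac-xE⁻¹ true (c , f))) (ψψ f))

  act-pow-σ₁² : ∀ n → act (pow (σ₁ · σ₁) n) base ≡ ((S.[ + n ] , 0R) , false , false)
  act-pow-σ₁² zero    = refl
  act-pow-σ₁² (suc n) = trans (cong (act (σ₁ · σ₁)) (act-pow-σ₁² n)) (cong (_, false , false)
    (trans (xE-xE S.[ + n ] 0R) (cong₂ _,_ (sym (S-[suc] n))
      (solve 1 (λ r → con (+ 0) :- r :* con (+ 0) := con (+ 0)) refl r))))
    where open R.Solver

  act-pow-σ₁-even : ∀ n p → act (pow σ₁ (2 ℕ.* n)) p ≡ act (pow (σ₁ · σ₁) n) p
  act-pow-σ₁-even zero    p = refl
  act-pow-σ₁-even (suc n) p = trans (cong (λ l → act (pow σ₁ l) p) (ℕ.*-suc 2 n))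
    (cong (λ x → act σ₁ (act σ₁ x)) (act-pow-σ₁-even n p))

  edgeWord : E → Word
  edgeWord (c , f) = pow σ₂ (toℕ f) · pow (σ₁ · σ₁) (toℕ c)

  act-edgeWord : ∀ e → act (edgeWord e) base ≡ (e , false , false)
  act-edgeWord (c , f) = begin
    act (pow σ₂ (toℕ f)) (act (pow (σ₁ · σ₁) (toℕ c)) base)    ≡⟨ cong (act (pow σ₂ (toℕ f))) (act-pow-σ₁² (toℕ c)) ⟩
    act (pow σ₂ (toℕ f)) ((S.[ + toℕ c ] , 0R) , false , false) ≡⟨ act-pow-σ₂ (toℕ f) _ 0R false false ⟩
    ((S.[ + toℕ c ] , 0R + R.[ + toℕ f ]) , false , false)      ≡⟨ cong₂ (λ x y → (x , 0R + y) , false , false) (S.⟦⟧-section c) (R.⟦⟧-section f) ⟩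
    ((c , 0R + f) , false , false)                              ≡⟨ cong (λ x → (c , x) , false , false) (solve 1 (λ f → con (+ 0) :+ f := f) refl f) ⟩
    ((c , f) , false , false)                                   ∎
    where
    open ≡-Reasoning
    open R.Solver

  -- σ₁ flips both labels and σ₂ flips none, so the colour is invariant under the group, whereas
  -- each of `r₀`, `r₁`, `r₂` flips exactly one label.
  colour : Position → Bool
  colour (e , i , j) = i xor j

  white-orbit : ∀ p → colour p ≡ false → ∃ λ w → ⟪ w ⟫ ∶ base ↝ p
  white-orbit (e , false , false) _ = edgeWord e ,
    subst (⟪ edgeWord e ⟫ ∶ base ↝_) (act-edgeWord e) (word-sends (edgeWord e) base)
  white-orbit (e , true , true)   _ = w ,
    subst (⟪ w ⟫ ∶ base ↝_) (trans (cong (act σ₁) (act-edgeWord e′)) (cong (_, true , true) (xE-xE⁻¹ e)))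
      (word-sends w base)
    where
    e′ = xE⁻¹ e
    w = σ₁ · edgeWord e′

  -- Chirality.

  stepAA-black : ∀ c f → stepA (stepA ((c , f) , false , true)) ≡ ((c S.- 1S , f - r) , false , true)
  stepAA-black c f = trans (cong back (solve 2 (λ c x → c :- x :+ x :- con (+ 1) := c :- con (+ 1)) refl c (ρ g)))
    (cong (λ x → (c S.- 1S , x) , false , true)
      (trans (cong (λ x → g - (1R - x)) (trans (κ-minus c 1S) (cong (_-_ (κ c)) κ-1)))
        (R.Solver.solve 3 (λ f K r → f T.:+ (T.con (+ 1) T.:- K) T.:- (T.con (+ 1) T.:- (K T.:- r)) T.:= f T.:- r) refl f (κ c) r)))
    where
    open S.Solver
    module T = R.Solver
    g = f + (1R - κ c)
    back : Fin m → Position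
    back x = (x , g - (1R - κ x)) , false , true

  stepB-black : ∀ n c f → iterate stepB n ((c , f) , false , true) ≡ ((c , f - R.[ + n ] * (1R - κ c)) , false , true)
  stepB-black zero    c f = cong (λ x → (c , x) , false , true)
    (solve 2 (λ f t → f := f :- con (+ 0) :* t) refl f (1R - κ c))
    where open R.Solver
  stepB-black (suc n) c f = trans (cong stepB (stepB-black n c f)) (cong (λ x → (c , x) , false , true)
    (trans (solve 3 (λ f n t → f :- n :* t :- t := f :- (n :+ con (+ 1)) :* t) refl f R.[ + n ] (1R - κ c))
           (cong (λ x → f - x * (1R - κ c)) (sym ([suc] n)))))
    where open R.Solver

  -- Automorphisms commute with passing to adjacent flags, so σ₂^N σ₁² σ₂ = σ₂ σ₁² says
  -- that these two walks from the base flag end at the same flag.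
  walk₁ walk₂ : Position → Position
  walk₁ p = stepB (stepA (stepA (iterate stepB N p)))
  walk₂ p = stepA (stepA (stepB p))

  walks-close-white : walk₁ base ≡ walk₂ base
  walks-close-white = begin
    walk₁ base                                                               ≡⟨ cong (λ p → stepB (stepA (stepA p))) (stepB-white N 0S 0R) ⟩
    stepB (stepA (stepA ((0S , 0R + r * (1R - κ 0S)) , false , false)))      ≡⟨ cong stepB (stepAA-white 0S _) ⟩
    ((0S S.+ 1S , 0R + r * (1R - κ 0S) + (1R - κ (0S S.+ 1S))) , false , false)
      ≡⟨ cong (λ x → (0S S.+ 1S , x) , false , false) (trans (cong₂ (λ a b → 0R + r * (1R - a) + (1R - b)) κ-0 (trans (κ-+ 0S 1S) (cong₂ _+_ κ-0 κ-1)))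
           (trans (solve 1 (λ r → con (+ 0) :+ r :* (con (+ 1) :- con (+ 0)) :+ (con (+ 1) :- (con (+ 0) :+ r)) := con (+ 0) :+ (con (+ 1) :- con (+ 0))) refl r)
             (cong (λ a → 0R + (1R - a)) (sym κ-0)))) ⟩
    ((0S S.+ 1S , 0R + (1R - κ 0S)) , false , false)                         ≡⟨ stepAA-white 0S _ ⟨
    walk₂ base                                                               ∎
    where
    open ≡-Reasoning
    open R.Solver

  2r≢0 : r + r ≢ 0R
  2r≢0 eq = q∤2N (R.[]≡0⇒∣ (N ℕ.+ N) (trans (R.+-homo (+ N) (+ N)) eq))

  -- From the base flag the N turns at vertex 0 contribute +N, and the last turn, made at vertex 1,
  -- has length 1 - N, so the two twists cancel. From a black flag all turns run backwards while the
  -- vertex changes from c to c - 1, so the contributions add up to -2N. The loss of `r` in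
  -- `stepAA-black` is common to both walks.
  walks-open-black : ∀ c f → proj₁ (walk₁ ((c , f) , false , true)) ≢ proj₁ (walk₂ ((c , f) , false , true))
  walks-open-black c f eq = 2r≢0 (begin
    r + r                                                  ≡⟨ absorb (trans (cong (_* κ c) (sym κ-1)) (κκ≡0 1S c)) ⟨
    r + r + r * κ c * (- 1R)                               ≡⟨ solve 3 (λ f K r → r :+ r :+ r :* K :* (:- con (+ 1))
                                                               := f :- (con (+ 1) :- K) :- r :- (f :- r :* (con (+ 1) :- K) :- r :- (con (+ 1) :- (K :- r)))) refl f (κ c) r ⟩
    f - (1R - κ c) - r - (f - r * (1R - κ c) - r - (1R - (κ c - r)))   ≡⟨ cong₂ _-_ side₂ side₁ ⟨
    proj₂ (proj₁ (walk₂ p)) - proj₂ (proj₁ (walk₁ p))      ≡⟨ cong (λ x → proj₂ (proj₁ (walk₂ p)) - proj₂ x) eq ⟩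
    proj₂ (proj₁ (walk₂ p)) - proj₂ (proj₁ (walk₂ p))      ≡⟨ solve 1 (λ x → x :- x := con (+ 0)) refl _ ⟩
    0R                                                     ∎)
    where
    open ≡-Reasoning
    open R.Solver
    p = ((c , f) , false , true)
    side₁ : proj₂ (proj₁ (walk₁ p)) ≡ f - r * (1R - κ c) - r - (1R - (κ c - r))
    side₁ = trans (cong (λ p → proj₂ (proj₁ (stepB (stepA (stepA p))))) (stepB-black N c f))
      (trans (cong (λ p → proj₂ (proj₁ (stepB p))) (stepAA-black c (f - r * (1R - κ c))))
        (cong (λ x → f - r * (1R - κ c) - r - (1R - x)) (trans (κ-minus c 1S) (cong (_-_ (κ c)) κ-1))))
    side₂ : proj₂ (proj₁ (walk₂ p)) ≡ f - (1R - κ c) - r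
    side₂ = cong (λ p → proj₂ (proj₁ p)) (stepAA-black c (f - (1R - κ c)))

  module _ (α : Aut) where

    ↝-stepA : ∀ p p′ → α ∶ p ↝ p′ → α ∶ stepA p ↝ stepA p′
    ↝-stepA p p′ a = ↝-r₀ (r₁ p) (r₁ p′) (↝-r₁ p p′ a)

    ↝-stepB : ∀ p p′ → α ∶ p ↝ p′ → α ∶ stepB p ↝ stepB p′
    ↝-stepB p p′ a = ↝-r₁ (r₂ p) (r₂ p′) (↝-r₂ p p′ a)

    ↝-iterateB : ∀ n p p′ → α ∶ p ↝ p′ → α ∶ iterate stepB n p ↝ iterate stepB n p′
    ↝-iterateB zero    p p′ a = a
    ↝-iterateB (suc n) p p′ a = ↝-stepB (iterate stepB n p) (iterate stepB n p′) (↝-iterateB n p p′ a)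

    ↝-walk₁ : ∀ p p′ → α ∶ p ↝ p′ → α ∶ walk₁ p ↝ walk₁ p′
    ↝-walk₁ p p′ a = ↝-stepB (stepA (stepA b)) (stepA (stepA b′)) (↝-stepA (stepA b) (stepA b′) (↝-stepA b b′ (↝-iterateB N p p′ a)))
      where
      b = iterate stepB N p
      b′ = iterate stepB N p′

    ↝-walk₂ : ∀ p p′ → α ∶ p ↝ p′ → α ∶ walk₂ p ↝ walk₂ p′
    ↝-walk₂ p p′ a = ↝-stepA (stepA (stepB p)) (stepA (stepB p′)) (↝-stepA (stepB p) (stepB p′) (↝-stepB p p′ a))

  ↝-edge : ∀ {α p p′} → α ∶ p ↝ p′ → to (Aut.autE α) (proj₁ p) ≡ proj₁ p′
  ↝-edge a = proj₁ (proj₂ (flagwise a))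

  no-reflection : ∀ α p → α ∶ base ↝ p → colour p ≡ true → ⊥
  no-reflection α p@((c , f) , false , true) a _ = walks-open-black c f
    (trans (sym (↝-edge (↝-walk₁ α base p a)))
      (trans (cong (λ x → to (Aut.autE α) (proj₁ x)) walks-close-white) (↝-edge (↝-walk₂ α base p a))))
  -- Following with σ₁ flips both labels, which leads back to the first case.
  no-reflection α p@(e , true , false) a _ =
    no-reflection (_∘Aut_ polyhedron xAut α) (act σ₁ p) (↝-∘ xAut α p (x-sends e true false) a) refl

  open Presentation m q n₀ (+ 3) (+ suc N) using (_≈_; normalForm; pow-multiple)

  orbit : ∀ p p′ → colour p ≡ colour p′ → ∃ λ α → α ∶ p ↝ p′
  orbit p p′ eq = by-colour (colour p) refl
    where
    white : ∀ p p′ → colour p ≡ false → colour p′ ≡ false → ∃ λ α → α ∶ p ↝ p′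
    white p p′ cp cp′ with w , s ← white-orbit p cp | w′ , s′ ← white-orbit p′ cp′ =
      _∘Aut_ polyhedron ⟪ w′ ⟫ (invAut polyhedron ⟪ w ⟫) ,
      ↝-∘ ⟪ w′ ⟫ (invAut polyhedron ⟪ w ⟫) base s′ (↝-inv ⟪ w ⟫ base p s)
    r₂-white : ∀ p → colour p ≡ true → colour (r₂ p) ≡ false
    r₂-white (e , false , true) _ = refl
    r₂-white (e , true , false) _ = refl
    r₂-involutive : ∀ p → r₂ (r₂ p) ≡ p
    r₂-involutive (e , i , j) = cong (λ x → e , i , x) (Bool.not-involutive j)
    by-colour : ∀ b → colour p ≡ b → ∃ λ α → α ∶ p ↝ p′
    by-colour false cp = white p p′ cp (trans (sym eq) cp)
    -- The 2-adjacent flags of two black flags are white; an automorphism joining those also joins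
    -- the black flags.
    by-colour true  cp with α , s ← white (r₂ p) (r₂ p′) (r₂-white p cp) (r₂-white p′ (trans (sym eq) cp)) =
      α , subst₂ (α ∶_↝_) (r₂-involutive p) (r₂-involutive p′) (↝-r₂ (r₂ p) (r₂ p′) s)

  isChiral : IsChiral polyhedron
  isChiral = flagColour , adjacent , transitive , intransitive
    where
    flagColour : Flag → Bool
    flagColour Φ = colour (position Φ)
    adjacent : ∀ i Φ Ψ → Adj i Φ Ψ → flagColour Φ ≢ flagColour Ψ
    adjacent Fin.zero Φ Ψ (v≢ , e≡ , f≡) eq = v≢ (begin
      fv Φ                       ≡⟨ inc-vtx (fv Φ) (fe Φ) (ve Φ) ⟩
      vtx (proj₁ (fv Φ)) (fe Φ)  ≡⟨ cong₂ vtx (xor-cancelʳ (side (fe Ψ) (ff Ψ))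
                                      (trans (cong₂ (λ e f → proj₁ (fv Φ) xor side e f) (sym e≡) (sym f≡)) eq)) e≡ ⟩
      vtx (proj₁ (fv Ψ)) (fe Ψ)  ≡⟨ inc-vtx (fv Ψ) (fe Ψ) (ve Ψ) ⟨
      fv Ψ                       ∎)
      where open ≡-Reasoning
    adjacent (Fin.suc Fin.zero) Φ Ψ (v≡ , e≢ , f≡) eq = e≢ (begin
      fe Φ                                        ≡⟨ edgeAt-side (fv Φ) (fe Φ) (ff Φ) (ve Φ) (ef Φ) ⟨
      edgeAt (fv Φ) (ff Φ) (side (fe Φ) (ff Φ))   ≡⟨ cong (edgeAt (fv Φ) (ff Φ)) (xor-cancelˡ (proj₁ (fv Φ))
                                                       (trans eq (cong (λ v → proj₁ v xor side (fe Ψ) (ff Ψ)) (sym v≡)))) ⟩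
      edgeAt (fv Φ) (ff Φ) (side (fe Ψ) (ff Ψ))   ≡⟨ cong₂ (λ v f → edgeAt v f (side (fe Ψ) (ff Ψ))) v≡ f≡ ⟩
      edgeAt (fv Ψ) (ff Ψ) (side (fe Ψ) (ff Ψ))   ≡⟨ edgeAt-side (fv Ψ) (fe Ψ) (ff Ψ) (ve Ψ) (ef Ψ) ⟩
      fe Ψ                                        ∎)
      where open ≡-Reasoning
    adjacent (Fin.suc (Fin.suc Fin.zero)) Φ Ψ (v≡ , e≡ , f≢) eq = f≢ (begin
      ff Φ                             ≡⟨ inc-fac (fe Φ) (ff Φ) (ef Φ) ⟩
      fac (side (fe Φ) (ff Φ)) (fe Φ)  ≡⟨ cong₂ fac (xor-cancelˡ (proj₁ (fv Φ))
                                            (trans eq (cong (λ v → proj₁ v xor side (fe Ψ) (ff Ψ)) (sym v≡)))) e≡ ⟩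
      fac (side (fe Ψ) (ff Ψ)) (fe Ψ)  ≡⟨ inc-fac (fe Ψ) (ff Ψ) (ef Ψ) ⟨
      ff Ψ                             ∎)
      where open ≡-Reasoning
    transitive : ∀ b → TransitiveOn polyhedron (λ Φ → flagColour Φ ≡ b)
    transitive b Φ Ψ cΦ cΨ with α , s ← orbit (position Φ) (position Ψ) (trans cΦ (sym cΨ)) =
      α , subst₂ (Maps-flag α) (toFlag-position Φ) (toFlag-position Ψ) (flagwise s)
    intransitive : ¬ TransitiveOn polyhedron (λ _ → ⊤)
    intransitive tr with α , s ← tr (toFlag base) (toFlag (r₂ base)) tt tt = no-reflection α (r₂ base) (sends s) refl

  adj-r₀ : ∀ p → Adj Fin.zero (toFlag p) (toFlag (r₀ p))
  adj-r₀ (e , i , j) = (λ eq → not≢ (sym (cong proj₁ eq))) , refl , refl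

  adj-r₁ : ∀ p → Adj (Fin.suc Fin.zero) (toFlag p) (toFlag (r₁ p))
  adj-r₁ (e , i , j) = sym (vtx-edgeAt (vtx i e) (fac j e) (not j)) ,
    (λ eq → edgeAt-not≢ i j e (sym eq)) , sym (fac-edgeAt (vtx i e) (fac j e) (not j))

  adj-r₂ : ∀ p → Adj (Fin.suc (Fin.suc Fin.zero)) (toFlag p) (toFlag (r₂ p))
  adj-r₂ (e , i , j) = refl , refl , (λ eq → not≢ (sym (fac-injective j (not j) e eq)))

  -- The defining relations at the base flag.

  ρ-0 : ρ 0R ≡ 0S
  ρ-0 = ρ-[] (+ 0)

  ρ-1 : ρ 1R ≡ 1S
  ρ-1 = ρ-[] (+ 1)

  fac-true-base : fac true (0S , 0R) ≡ 1R
  fac-true-base = trans (cong (λ x → 0R + (1R - x)) κ-0)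
    (solve 0 (con (+ 0) :+ (con (+ 1) :- con (+ 0)) := con (+ 1)) refl)
    where open R.Solver

  idx-true-base : idx true (0S , 0R) ≡ 0S
  idx-true-base = trans (cong (λ x → 0S S.- x) ρ-0) (solve 0 (con (+ 0) :- con (+ 0) := con (+ 0)) refl)
    where open S.Solver

  φ-1 : φ 1R ≡ - 1R
  φ-1 = solve 1 (λ s → :- con (+ 1) :- s :* (con (+ 1) :* (con (+ 1) :- con (+ 1))) := :- con (+ 1)) refl s
    where open R.Solver

  ψ-1 : ψ 1R ≡ - 1R - r
  ψ-1 = trans (solve 1 (λ s → :- con (+ 1) :- s :* (con (+ 1) :* (con (+ 1) :+ con (+ 1))) := :- con (+ 1) :- (s :+ s)) refl s)
    (cong (λ x → - 1R - x) (sym r≡s+s))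
    where open R.Solver

  σ₁-base : act σ₁ base ≡ ((0S , - 1R) , true , true)
  σ₁-base = cong₂ (λ a b → (a , b) , true , true) idx-true-base (trans (cong φ fac-true-base) φ-1)

  σ₁⁻¹-base : act (σ₁ ⁻¹) base ≡ ((0S S.- 1S , - 1R - r) , true , true)
  σ₁⁻¹-base = cong₂ (λ a b → (a , b) , true , true) (cong (S._- 1S) idx-true-base) (trans (cong ψ fac-true-base) ψ-1)

  σ₂^-base : ∀ n → act (pow σ₂ n) base ≡ ((0S , R.[ + n ]) , false , false)
  σ₂^-base n = trans (act-pow-σ₂ n 0S 0R false false)
    (cong (λ x → (0S , x) , false , false) (solve 1 (λ x → con (+ 0) :+ x := x) refl R.[ + n ]))
    where open R.Solver

  distinguished₁ : act σ₁ base ≡ stepA base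
  distinguished₁ = trans σ₁-base (cong (λ x → (0S , x) , true , true) (trans
    (solve 0 (:- con (+ 1) := con (+ 0) :- (con (+ 1) :- con (+ 0))) refl) (cong (λ x → 0R - (1R - x)) (sym κ-0))))
    where open R.Solver

  distinguished₂ : act σ₂ base ≡ stepB base
  distinguished₂ = cong (λ x → (0S , x) , false , false) (trans
    (solve 0 (con (+ 0) :+ con (+ 1) := con (+ 1)) refl) (sym fac-true-base))
    where open R.Solver

  relation₁ : act (pow σ₁ (2 ℕ.* m)) base ≡ base
  relation₁ = trans (act-pow-σ₁-even m base) (trans (act-pow-σ₁² m)
    (cong (λ x → (x , 0R) , false , false) (S.[]-cong {+ m} {+ 0} (divides (+ 1)
      (solve 1 (λ x → x :- con (+ 0) := con (+ 1) :* x) refl (+ m))))))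
    where open +-*-Solver

  relation₂ : act (pow σ₂ q) base ≡ base
  relation₂ = trans (σ₂^-base q)
    (cong (λ x → (0S , x) , false , false) (R.[]-cong {+ q} {+ 0} (divides (+ 1)
      (solve 1 (λ x → x :- con (+ 0) := con (+ 1) :* x) refl (+ q)))))
    where open +-*-Solver

  relation₃ : act (pow (σ₁ · σ₂) 2) base ≡ base
  relation₃ = cong (_, false , false) (cong₂ _,_ onS onR)
    where
    e₁ = yE (0S , 0R)
    e₂ = xE e₁
    onS : idx true (yE e₂) ≡ 0S
    onS = trans (cong proj₂ (vtx-yE true e₂)) (trans (cong (λ v → proj₂ v S.- 1S) (vtx-xE true e₁)) (S-add-sub 0S))
    onR : φ (fac true (yE e₂)) ≡ 0R
    onR = begin
      φ (fac true (yE e₂))       ≡⟨ cong φ (fac-yE true e₂) ⟩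
      φ (fac true e₂ + 1R)       ≡⟨ cong (λ x → φ (x + 1R)) (fac-xE true e₁) ⟩
      φ (φ (0R + 1R) + 1R)       ≡⟨ cong (λ x → φ (φ x + 1R)) (solve 0 (con (+ 0) :+ con (+ 1) := con (+ 1)) refl) ⟩
      φ (φ 1R + 1R)              ≡⟨ cong (λ x → φ (x + 1R)) φ-1 ⟩
      φ (- 1R + 1R)              ≡⟨ solve 1 (λ s → let z = :- con (+ 1) :+ con (+ 1) in :- z :- s :* (z :* (z :- con (+ 1))) := con (+ 0)) refl s ⟩
      0R                         ∎
      where
      open ≡-Reasoning
      open R.Solver

  rr≡0 : r * r ≡ 0R
  rr≡0 = trans (cong₂ _*_ (sym κ-1) (sym κ-1)) (κκ≡0 1S 1S)

  -- σ₁² takes the face coordinate 1 + N to (1 + N)(1 - N) = 1. The third σ₁ meets the edge (1 , 1),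
  -- whose second face is 2 - N = 2 - 2s, and `φ` sends this to -2 modulo s².
  relation₄ : act (σ₂ ⁻¹ · σ₁) base ≡ act (pow σ₁ 3 · pow σ₂ (suc N)) base
  relation₄ = trans (cong (act (σ₂ ⁻¹)) σ₁-base) (sym (begin
    act (pow σ₁ 3) (act (pow σ₂ (suc N)) base)                ≡⟨ cong (act (pow σ₁ 3)) (σ₂^-base (suc N)) ⟩
    (xE (xE (xE (0S , R.[ + suc N ]))) , true , true)         ≡⟨ cong (λ e → e , true , true) (trans rotate step) ⟩
    ((0S , - 1R - 1R) , true , true)                          ∎))
    where
    open ≡-Reasoning
    rotate : xE (xE (xE (0S , R.[ + suc N ]))) ≡ xE (0S S.+ 1S , 1R)
    rotate = trans (cong xE (xE-xE 0S R.[ + suc N ]))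
      (cong (λ x → xE (0S S.+ 1S , x)) (trans (cong (λ x → x - r * x) ([suc] N))
        (trans (solve 1 (λ r → r :+ con (+ 1) :- r :* (r :+ con (+ 1)) := con (+ 1) :+ r :* r :* (:- con (+ 1))) refl r) (absorb rr≡0))))
      where open R.Solver
    step : xE (0S S.+ 1S , 1R) ≡ (0S , - 1R - 1R)
    step = cong₂ _,_
      (trans (cong (λ x → 0S S.+ 1S S.- x) ρ-1) (S-add-sub 0S))
      (trans (cong (λ x → φ (1R + (1R - x))) (trans (κ-+ 0S 1S) (cong₂ _+_ κ-0 (trans κ-1 r≡s+s))))
        (trans (solve 1 (λ s → let g = con (+ 1) :+ (con (+ 1) :- (con (+ 0) :+ (s :+ s))) in
            :- g :- s :* (g :* (g :- con (+ 1)))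
            := :- con (+ 1) :- con (+ 1) :+ s :* s :* (con (+ 6) :- con (+ 4) :* s)) refl s)
          (absorb ss≡0)))
      where open R.Solver

  -- σ₁⁻² takes the face coordinate N - 1 to (N - 1)(1 + N) = -1. The third σ₁⁻¹ meets the edge (-1
  -- , -1), whose second face is N = 2s, and `ψ` sends this to -N modulo s².
  relation₅ : act (σ₂ · σ₁ ⁻¹) base ≡ act (pow (σ₁ ⁻¹) 3 · pow σ₂ n₀) base
  relation₅ = trans (cong (act σ₂) σ₁⁻¹-base) (sym (begin
    act (pow (σ₁ ⁻¹) 3) (act (pow σ₂ n₀) base)                ≡⟨ cong (act (pow (σ₁ ⁻¹) 3)) (σ₂^-base n₀) ⟩
    (xE⁻¹ (xE⁻¹ (xE⁻¹ (0S , R.[ + n₀ ]))) , true , true)      ≡⟨ cong (λ e → e , true , true) (trans rotate step) ⟩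
    ((0S S.- 1S , - 1R - r + 1R) , true , true)               ∎))
    where
    open ≡-Reasoning
    n₀≡ : R.[ + n₀ ] ≡ r - 1R
    n₀≡ = trans (sym (R-add-sub _)) (cong (_- 1R) (trans (sym ([suc] n₀)) (cong (λ x → R.[ + x ]) (sym N≡1+n₀))))
    rotate : xE⁻¹ (xE⁻¹ (xE⁻¹ (0S , R.[ + n₀ ]))) ≡ xE⁻¹ (0S S.- 1S , - 1R)
    rotate = trans (cong xE⁻¹ (xE⁻¹-xE⁻¹ 0S R.[ + n₀ ]))
      (cong (λ x → xE⁻¹ (0S S.- 1S , x)) (trans (cong (λ x → x + r * x) n₀≡)
        (trans (solve 1 (λ r → r :- con (+ 1) :+ r :* (r :- con (+ 1)) := :- con (+ 1) :+ r :* r :* con (+ 1)) refl r) (absorb rr≡0))))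
      where open R.Solver
    step : xE⁻¹ (0S S.- 1S , - 1R) ≡ (0S S.- 1S , - 1R - r + 1R)
    step = cong₂ _,_
      (trans (cong (λ x → 0S S.- 1S S.- x S.- 1S) (trans (ρ-neg 1R) (cong (λ x → S.- x) ρ-1)))
        (S.Solver.solve 0 (T.con (+ 0) T.:- T.con (+ 1) T.:- (T.:- T.con (+ 1)) T.:- T.con (+ 1) T.:= T.con (+ 0) T.:- T.con (+ 1)) refl))
      (trans (cong (λ x → ψ (- 1R + (1R - x))) (trans (κ-minus 0S 1S) (cong₂ _-_ κ-0 (trans κ-1 r≡s+s))))
        (trans (solve 1 (λ s → let g = :- con (+ 1) :+ (con (+ 1) :- (con (+ 0) :- (s :+ s))) in
            :- g :- s :* (g :* (g :+ con (+ 1)))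
            := :- con (+ 1) :- (s :+ s) :+ con (+ 1) :+ s :* s :* (:- (con (+ 2) :+ con (+ 4) :* s))) refl s)
          (trans (absorb ss≡0) (cong (λ x → - 1R - x + 1R) (sym r≡s+s)))))
      where
      open R.Solver
      module T = S.Solver

  relator-sound : ∀ u w → act u base ≡ act w base → toMaps ⟪ u ⟫ ≐ toMaps ⟪ w ⟫
  relator-sound u w eq = rigidity ⟪ u ⟫ ⟪ w ⟫ (word-sends u base)
    (subst (⟪ w ⟫ ∶ base ↝_) (sym eq) (word-sends w base))

  -- The group axioms hold for composites and inverses of bijections; only the five relators need
  -- geometry, and `rigidity` reduces each of them to the base flag.
  sound : ∀ {u w} → u ≈ w → toMaps ⟪ u ⟫ ≐ toMaps ⟪ w ⟫
  sound (≈-refl {w}) = ≐-refl polyhedron (toMaps ⟪ w ⟫)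
  sound (≈-sym {u} {w} eq) = ≐-sym polyhedron (toMaps ⟪ u ⟫) (toMaps ⟪ w ⟫) (sound eq)
  sound (≈-trans {u} {v} {w} eq eq′) = ≐-trans polyhedron (toMaps ⟪ u ⟫) (toMaps ⟪ v ⟫) (toMaps ⟪ w ⟫) (sound eq) (sound eq′)
  sound (·-cong {u} {u′} {w} {w′} eq eq′) =
    comp-cong polyhedron (toMaps ⟪ u ⟫) (toMaps ⟪ u′ ⟫) (toMaps ⟪ w ⟫) (toMaps ⟪ w′ ⟫) (sound eq) (sound eq′)
  sound (⁻¹-cong {u} {w} eq) = invMaps-cong polyhedron ⟪ u ⟫ ⟪ w ⟫ (sound eq)
  sound (assoc u v w) = ≐-refl polyhedron (toMaps ⟪ u · v · w ⟫)
  sound (idˡ w) = ≐-refl polyhedron (toMaps ⟪ w ⟫)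
  sound (idʳ w) = ≐-refl polyhedron (toMaps ⟪ w ⟫)
  sound (invˡ w) = Inverse.strictlyInverseʳ A.autV , Inverse.strictlyInverseʳ A.autE , Inverse.strictlyInverseʳ A.autF
    where module A = Aut ⟪ w ⟫
  sound (invʳ w) = Inverse.strictlyInverseˡ A.autV , Inverse.strictlyInverseˡ A.autE , Inverse.strictlyInverseˡ A.autF
    where module A = Aut ⟪ w ⟫
  sound rel₁ = relator-sound (pow σ₁ (2 ℕ.* m)) ε relation₁
  sound rel₂ = relator-sound (pow σ₂ q) ε relation₂
  sound rel₃ = relator-sound (pow (σ₁ · σ₂) 2) ε relation₃
  sound rel₄ = relator-sound (σ₂ ⁻¹ · σ₁) (pow σ₁ 3 · pow σ₂ (suc N)) relation₄
  sound rel₅ = relator-sound (σ₂ · σ₁ ⁻¹) (pow (σ₁ ⁻¹) 3 · pow σ₂ n₀) relation₅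

  -- The action is faithful and gives all automorphisms.

  Trivial : Word → Set
  Trivial w = toMaps ⟪ w ⟫ ≐ toMaps ⟪ ε ⟫

  -- An odd power of σ₁ exchanges the two copies of ℤ/m and σ₂ preserves each, so the base vertex is
  -- moved.
  odd-nontrivial : ∀ f c → ¬ Trivial (pow σ₂ f · pow σ₁ (suc (2 ℕ.* c)))
  odd-nontrivial f c trivial = contradiction (trans (sym (proj₁ trivial (false , 0S))) (proj₁ (flagwise image))) λ ()
    where
    w = pow σ₂ f · pow σ₁ (suc (2 ℕ.* c))
    e = xE (S.[ + c ] , 0R)
    image : ⟪ w ⟫ ∶ base ↝ ((proj₁ e , proj₂ e + R.[ + f ]) , true , true)
    image = subst (⟪ w ⟫ ∶ base ↝_)
      (trans (cong (λ p → act (pow σ₂ f) (act σ₁ p)) (trans (act-pow-σ₁-even c base) (act-pow-σ₁² c)))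
             (act-pow-σ₂ f (proj₁ e) (proj₂ e) true true))
      (word-sends w base)

  -- The base edge goes to the edge with coordinates c and f; fixing it forces m to divide c and q
  -- to divide f, and then each factor is trivial by its own power relation.
  even-trivial : ∀ f c → Trivial (pow σ₂ f · pow σ₁ (2 ℕ.* c)) → pow σ₂ f · pow σ₁ (2 ℕ.* c) ≈ ε
  even-trivial f c trivial = ≈-trans (·-cong (f-trivial (R.[]≡0⇒∣ f f≡0)) (c-trivial (S.[]≡0⇒∣ c (cong proj₁ fixed)))) (idˡ ε)
    where
    w = pow σ₂ f · pow σ₁ (2 ℕ.* c)
    image : ⟪ w ⟫ ∶ base ↝ ((S.[ + c ] , 0R + R.[ + f ]) , false , false)
    image = subst (⟪ w ⟫ ∶ base ↝_)
      (trans (cong (act (pow σ₂ f)) (trans (act-pow-σ₁-even c base) (act-pow-σ₁² c))) (act-pow-σ₂ f S.[ + c ] 0R false false))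
      (word-sends w base)
    fixed : (S.[ + c ] , 0R + R.[ + f ]) ≡ (0S , 0R)
    fixed = trans (sym (↝-edge image)) (proj₁ (proj₂ trivial) (0S , 0R))
    f≡0 : R.[ + f ] ≡ 0R
    f≡0 = trans (solve 1 (λ x → x := con (+ 0) :+ x) refl R.[ + f ]) (cong proj₂ fixed)
      where open R.Solver
    f-trivial : q ℕ.∣ f → pow σ₂ f ≈ ε
    f-trivial (ℕ.divides d eq) = subst (λ n → pow σ₂ n ≈ ε) (sym eq) (pow-multiple d rel₂)
    c-trivial : m ℕ.∣ c → pow σ₁ (2 ℕ.* c) ≈ ε
    c-trivial (ℕ.divides d eq) =
      subst (λ n → pow σ₁ n ≈ ε) (sym (trans (cong (2 ℕ.*_) eq) (x∙yz≈y∙xz 2 d m))) (pow-multiple d rel₁)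

  normalForm-kernel : ∀ f a → Trivial (pow σ₂ f · pow σ₁ a) → pow σ₂ f · pow σ₁ a ≈ ε
  normalForm-kernel f a = by-parity (even-or-odd a)
    where
    Kernel : ℕ → Set
    Kernel a = Trivial (pow σ₂ f · pow σ₁ a) → pow σ₂ f · pow σ₁ a ≈ ε
    by-parity : (∃ λ c → a ≡ 2 ℕ.* c ⊎ a ≡ suc (2 ℕ.* c)) → Kernel a
    by-parity (c , inj₁ eq) = subst Kernel (sym eq) (even-trivial f c)
    by-parity (c , inj₂ eq) = subst Kernel (sym eq) (λ trivial → contradiction trivial (odd-nontrivial f c))

  faithful : ∀ u w → toMaps ⟪ u ⟫ ≐ toMaps ⟪ w ⟫ → u ≈ w
  faithful u w (eqV , eqE , eqF) with f , a , eq ← normalForm (u · w ⁻¹) =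
    ≈-trans (≈-sym (idʳ u)) (≈-trans (·-cong ≈-refl (≈-sym (invˡ w))) (≈-trans (≈-sym (assoc u (w ⁻¹) w))
      (≈-trans (·-cong (≈-trans eq (normalForm-kernel f a kernel)) ≈-refl) (idˡ w))))
    where
    module B = Aut ⟪ w ⟫
    quotient-trivial : toMaps ⟪ u · w ⁻¹ ⟫ ≐ toMaps ⟪ ε ⟫
    quotient-trivial =
      (λ v → trans (eqV (from B.autV v)) (Inverse.strictlyInverseˡ B.autV v)) ,
      (λ e → trans (eqE (from B.autE e)) (Inverse.strictlyInverseˡ B.autE e)) ,
      (λ x → trans (eqF (from B.autF x)) (Inverse.strictlyInverseˡ B.autF x))
    kernel : toMaps ⟪ pow σ₂ f · pow σ₁ a ⟫ ≐ toMaps ⟪ ε ⟫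
    kernel = ≐-trans polyhedron _ (toMaps ⟪ u · w ⁻¹ ⟫) _ (sound (≈-sym eq)) quotient-trivial

  -- The image of the base flag is white by `no-reflection`, hence is also reached by a word, and
  -- `rigidity` identifies the two automorphisms.
  surjective : ∀ α → ∃ λ w → toMaps ⟪ w ⟫ ≐ toMaps α
  surjective α = by-colour (colour p) refl
    where
    open Aut α
    image : Flag
    image = flag (to autV (false , 0S)) (to autE (0S , 0R)) (to autF 0R)
      (trans (pres-VE (false , 0S) (0S , 0R)) (vtx-inc false (0S , 0R)))
      (trans (pres-EF (0S , 0R) 0R) (fac-inc false (0S , 0R))) refl
    p = position image
    α-sends : α ∶ base ↝ p
    α-sends = sends (subst (Maps-flag α (toFlag base)) (sym (toFlag-position image)) (refl , refl , refl))
    by-colour : ∀ b → colour p ≡ b → ∃ λ w → toMaps ⟪ w ⟫ ≐ toMaps α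
    by-colour false cp with w , s ← white-orbit p cp = w , rigidity ⟪ w ⟫ α s α-sends
    by-colour true  cp = ⊥-elim (no-reflection α p α-sends cp)

  isAutGroupOf : IsAutGroupOf polyhedron (2 ℕ.* m) q (+ 3) (+ suc N) -[1+ 2 ] (+ n₀)
  isAutGroupOf = toFlag base , xAut , yAut ,
    (toFlag (r₁ base) , toFlag (stepA base) , adj-r₁ base , adj-r₀ (r₁ base) ,
      flagwise (subst (xAut ∶ base ↝_) distinguished₁ (word-sends σ₁ base))) ,
    (toFlag (r₂ base) , toFlag (stepB base) , adj-r₂ base , adj-r₁ (r₂ base) ,
      flagwise (subst (yAut ∶ base ↝_) distinguished₂ (word-sends σ₂ base))) ,
    (λ u w eq → subst₂ _≐_ (maps-of u) (maps-of w) (sound eq)) ,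
    (λ u w eq → faithful u w (subst₂ _≐_ (sym (maps-of u)) (sym (maps-of w)) eq)) ,
    (λ α → let w , eq = surjective α in w , subst (_≐ toMaps α) (maps-of w) eq)
    where
    maps-of : ∀ w → toMaps ⟪ w ⟫ ≡ eval xAut yAut w
    maps-of = toMaps-evalAut polyhedron xAut yAut

-- Specialisation to an odd prime.

open import Data.Nat using (_≤_; _<_; _*_; _^_; _∸_; _%_; _/_; NonZero; nonTrivial⇒n>1)
open import Data.Integer using (-_) renaming (_+_ to _+ℤ_; _*_ to _*ℤ_)

theorem3p6 : (m β k : ℕ) → Prime m → m % 2 ≡ 1 → 2 ≤ β → 1 ≤ k → k ≤ m ∸ 1 →
    Σ RankedPoset λ P →
    IsPolyhedron P × HasType P (2 * m) (m ^ β) × IsChiral P × Tight P (2 * m) (m ^ β) ×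
    IsAutGroupOf P (2 * m) (m ^ β)
    (+ 3) (+ 1 +ℤ + k *ℤ + (m ^ (β ∸ 1)))
    (- (+ 3)) (- (+ 1) +ℤ + k *ℤ + (m ^ (β ∸ 1)))
theorem3p6 m (suc (suc b)) k m-prime m-odd _ 1≤k k≤m-1 =
  polyhedron , isPolyhedron , hasType , isChiral , tight ,
  subst₂ (λ j₁ j₂ → IsAutGroupOf polyhedron (2 * m) (m ^ suc (suc b)) (+ 3) j₁ (- (+ 3)) j₂)
    (cong (+ 1 +ℤ_) (ℤ.pos-* k M))
    -- -1 + (n + 1) computes to n, so rewriting the successor of the predecessor of kM as kM turns
    -- the exponent n₀ into -1 + kM.
    (trans (cong (λ n → - (+ 1) +ℤ + n) (ℕ.suc-pred (k * M))) (cong (- (+ 1) +ℤ_) (ℤ.pos-* k M)))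
    isAutGroupOf
  where
  M : ℕ
  M = m ^ suc b

  instance
    m≢0 : NonZero m
    m≢0 = prime⇒nonZero m-prime
    k≢0 : NonZero k
    k≢0 = ℕ.>-nonZero 1≤k
    M≢0 : NonZero M
    M≢0 = ℕ.m^n≢0 m (suc b)
    q≢0 : NonZero (m * M)
    q≢0 = ℕ.m*n≢0 m M
    N≢0 : NonZero (k * M)
    N≢0 = ℕ.m*n≢0 k M

  1<m : 1 < m
  1<m = nonTrivial⇒n>1 m {{prime⇒nonTrivial m-prime}}

  2h≡1+m : suc (m / 2) ℕ.+ suc (m / 2) ≡ suc m
  2h≡1+m = begin
    suc (m / 2) ℕ.+ suc (m / 2)      ≡⟨ cong suc (ℕ.+-suc (m / 2) (m / 2)) ⟩
    2 ℕ.+ (m / 2 ℕ.+ m / 2)          ≡⟨ cong (λ x → 2 ℕ.+ (m / 2 ℕ.+ x)) (ℕ.+-identityʳ (m / 2)) ⟨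
    2 ℕ.+ 2 * (m / 2)                ≡⟨ cong (2 ℕ.+_) (ℕ.*-comm 2 (m / 2)) ⟩
    2 ℕ.+ m / 2 * 2                  ≡⟨ cong (λ x → suc (x ℕ.+ m / 2 * 2)) m-odd ⟨
    suc (m % 2 ℕ.+ m / 2 * 2)        ≡⟨ cong suc (m≡m%n+[m/n]*n m 2) ⟨
    suc m                            ∎
    where open ≡-Reasoning

  m∤2 : ¬ (m ℕ.∣ 2)
  m∤2 m∣2 with ℕ.≤-antisym (ℕ.∣⇒≤ m∣2) 1<m
  ... | refl = contradiction m-odd λ ()

  m∤k : ¬ (m ℕ.∣ k)
  m∤k m∣k = ℕ.<⇒≱ (ℕ.≤-<-trans k≤m-1 (ℕ.∸-monoʳ-< (ℕ.s≤s ℕ.z≤n) (ℕ.<⇒≤ 1<m))) (ℕ.∣⇒≤ m∣k)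

  double : k * M ℕ.+ k * M ≡ 2 * k * M
  double = trans (cong (k * M ℕ.+_) (sym (ℕ.+-identityʳ (k * M)))) (sym (ℕ.*-assoc 2 k M))

  -- Cancelling M leaves m dividing 2k. This is the single place where primality excludes a
  -- reflection: m divides neither 2, being odd, nor k, being larger than k.
  q∤2N : ¬ (m * M ℕ.∣ k * M ℕ.+ k * M)
  q∤2N q∣2N with euclidsLemma 2 k m-prime (ℕ.*-cancelʳ-∣ M (subst (m * M ℕ.∣_) double q∣2N))
  ... | inj₁ m∣2 = m∤2 m∣2
  ... | inj₂ m∣k = m∤k m∣k

  -- With β = b + 2 the power m^β unfolds to m · (m · m^b), so L is m^b. The inverse of 2 modulo m
  -- is (m + 1)/2, which for odd m is one more than the floor of m/2.
  open Realisation m (m ^ b) k (suc (m / 2)) 2h≡1+m 1<m q∤2N (ℕ.pred (k * M)) (sym (ℕ.suc-pred (k * M)))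
theorem3p6 m (suc zero) k _ _ (ℕ.s≤s ()) _ _
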